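{- For all sufficiently large $n$, there exists a multigraph $G$ which simultaneously maximizes $P$ over $D(n)$ and maximizes $P$ over $W(n)$ (in particular $G\in W(n)$).
   Context: A multigraph is $(V,w)$ with $w:\binom V2\to\mathbb{N}$; $\mu(G)=\max w$, $P(G)=\prod_{xy}w(xy)$. An $(s,q)$-graph is a multigraph in which every $s$ vertices span total multiplicity at most $q$; $F(n,s,q)$ is the set of $(s,q)$-graphs on $[n]$. $D(n)=\{G\in F(n,4,15):\mu(G)\le 3\}\cap F(n,3,8)$. $W(n)$ is the set of multigraphs $([n],w)$ for which there is a partition $L,R$ of $[n]$ with $w=1$ on $\binom L2$, $w=2$ on $\binom R2$, $w=3$ on pairs between $L$ and $R$. -}

module Defs where

open import Data.Nat using (ℕ; _+_; _*_; _≤_; _<_; _<?_; _⊔_)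
open import Data.Bool using (Bool; true; false)
open import Data.Fin using (Fin; toℕ)
open import Data.Fin.Subset using (Subset; _∈_; ∣_∣)
open import Data.Fin.Subset.Properties using (_∈?_)
open import Data.Vec using (lookup)
open import Data.List using (List; map; filter; foldr; cartesianProduct; allFin)
open import Data.Nat.ListAction using (sum; product)
open import Data.Product using (_×_; _,_; proj₁; proj₂; Σ)
open import Relation.Nullary.Decidable using (_×-dec_)
open import Relation.Binary.PropositionalEquality using (_≡_)

-- A multigraph on [n] = Fin n: a weight function on pairs; only the
-- values w i j with toℕ i < toℕ j are used (each unordered pair {i,j}
-- is represented by its ordered representative i < j).
Multigraph : ℕ → Set
Multigraph n = Fin n → Fin n → ℕ

pairs : (n : ℕ) → List (Fin n × Fin n)
pairs n = filter (λ p → toℕ (proj₁ p) <? toℕ (proj₂ p))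
                 (cartesianProduct (allFin n) (allFin n))

weights : {n : ℕ} → Multigraph n → List (Fin n × Fin n) → List ℕ
weights w = map (λ p → w (proj₁ p) (proj₂ p))

μ : {n : ℕ} → Multigraph n → ℕ
μ {n} w = foldr _⊔_ 0 (weights w (pairs n))

P : {n : ℕ} → Multigraph n → ℕ
P {n} w = product (weights w (pairs n))

pairsIn : {n : ℕ} → Subset n → List (Fin n × Fin n)
pairsIn {n} S = filter (λ p → (proj₁ p ∈? S) ×-dec (proj₂ p ∈? S)) (pairs n)

span : {n : ℕ} → Multigraph n → Subset n → ℕ
span w S = sum (weights w (pairsIn S))

IsSQ : (s q : ℕ) → {n : ℕ} → Multigraph n → Set
IsSQ s q {n} w = (S : Subset n) → ∣ S ∣ ≡ s → span w S ≤ q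

InD : {n : ℕ} → Multigraph n → Set
InD w = IsSQ 4 15 w × μ w ≤ 3 × IsSQ 3 8 w

-- weight pattern: true = in L, false = in R
crossW : Bool → Bool → ℕ
crossW true  true  = 1
crossW false false = 2
crossW true  false = 3
crossW false true  = 3

InW : {n : ℕ} → Multigraph n → Set
InW {n} w = Σ (Subset n) λ L →
  (i j : Fin n) → toℕ i < toℕ j → w i j ≡ crossW (lookup L i) (lookup L j)

Maximizes : {n : ℕ} → (Multigraph n → Set) → Multigraph n → Set
Maximizes {n} F G = F G × ((H : Multigraph n) → F H → P H ≤ P G)

{-# OPTIONS --safe #-}
module Submission where

-- Put weight 1 on the diagonal. Then membership in D(n), for weights 1, 2, 3,
-- says that the weight-3 edges form no triangle and that each of their 4-cycles has a diagonal of
-- weight 1, and this is inherited by pullbacks along arbitrary maps of vertices: deleting a vertex,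
-- and replacing vertices by clones joined by weight 1. Induct on n. If some vertex has degree
-- product below 2^(37n/32), delete it: the optimum over W(n) grows at least twice as fast.
-- Otherwise compare degrees: vertices joined by weight 1 may be assumed to have equal degree
-- (else clone the better one), and a vertex v with the largest number of 1-edges has at least
-- 85n/416 of them, because 3-neighbourhoods of 3-neighbours of v overlap little. Cloning v over all
-- of its 1-neighbours loses nothing, and then no vertex can be joined to v by weight 2: v sees only
-- weights 1 and 3, so the graph is dominated by a member of W(n). The factor gained at each deletion
-- makes up for the failure of the statement at small n (C₅ beats W(5)).

open import Defs
open import Algebra.Bundles using (CommutativeMonoid)
open import Data.Bool using (Bool; true; false; T; if_then_else_; _∧_; not)
open import Data.Empty using (⊥; ⊥-elim)
open import Data.Fin using (Fin; zero; suc; toℕ; punchIn)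
import Data.Fin.Properties as Fin
open import Data.Fin.Properties using (any?; nonZeroIndex)
open import Data.Fin.Subset using (Subset; ∣_∣)
import Data.Fin.Subset as Subset
open import Data.Fin.Subset.Properties using (_∈?_)
open import Data.List using (List; []; _∷_; _++_; map; filter; foldr; tabulate; cartesianProduct; length)
open import Data.List.Membership.Propositional using (_∈_)
open import Data.List.Membership.Propositional.Properties using (∈-filter⁺; ∈-cartesianProduct⁺; ∈-allFin)
open import Data.List.Relation.Unary.All using (All; []; _∷_)
open import Data.List.Relation.Unary.AllPairs using (AllPairs; []; _∷_)
open import Data.List.Relation.Unary.Any using (here; there)
open import Data.Nat
open import Data.Nat.ListAction using (sum; product)
open import Data.Nat.Properties
open import Data.Nat.Tactic.RingSolver using (solve-∀)
open import Data.Product using (Σ; ∃; _×_; _,_; proj₁; proj₂)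
open import Data.Sum using (_⊎_; inj₁; inj₂)
open import Data.Vec using ([]; _∷_; lookup; _[_]≔_)
import Data.Vec as Vec
open import Data.Vec.Properties using (lookup-replicate; lookup∘updateAt′; lookup∘tabulate)
open import Function using (_∘_; id)
open import Level using (0ℓ)
open import Relation.Binary.PropositionalEquality
open import Relation.Nullary using (Dec; does; yes; no; ¬_)
open import Relation.Nullary.Decidable using (_×-dec_)
open import Relation.Unary using (Pred; Decidable)

-- Folds over unordered pairs, for sums and for products.

module PairFold (M : CommutativeMonoid 0ℓ 0ℓ) where
  open CommutativeMonoid M renaming (refl to ≈-refl; sym to ≈-sym; trans to ≈-trans)
  open import Algebra.Properties.CommutativeMonoid.Sum M

  fold : List Carrier → Carrier
  fold = foldr _∙_ ε

  fold-filter : {A : Set} {Q : Pred A 0ℓ} (Q? : Decidable Q) (f : A → Carrier) (xs : List A) →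
                fold (map f (filter Q? xs)) ≈ fold (map (λ x → if does (Q? x) then f x else ε) xs)
  fold-filter Q? f [] = ≈-refl
  fold-filter Q? f (x ∷ xs) with does (Q? x)
  ... | false = ≈-trans (fold-filter Q? f xs) (≈-sym (identityˡ _))
  ... | true  = ∙-congˡ (fold-filter Q? f xs)

  fold-++ : {A : Set} (f : A → Carrier) (xs ys : List A) →
            fold (map f (xs ++ ys)) ≈ fold (map f xs) ∙ fold (map f ys)
  fold-++ f [] ys = ≈-sym (identityˡ _)
  fold-++ f (x ∷ xs) ys = ≈-trans (∙-congˡ (fold-++ f xs ys)) (≈-sym (assoc _ _ _))

  fold-row : {A B : Set} (f : B → Carrier) (h : A → B) {n : ℕ} (a : Fin n → A) →
             fold (map f (map h (tabulate a))) ≈ ∑[ i < n ] f (h (a i))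
  fold-row f h {zero} a = ≈-refl
  fold-row f h {suc n} a = ∙-congˡ (fold-row f h (a ∘ suc))

  fold-product : {A B : Set} (f : A × B → Carrier) {m n : ℕ} (a : Fin m → A) (b : Fin n → B) →
                 fold (map f (cartesianProduct (tabulate a) (tabulate b)))
                   ≈ ∑[ i < m ] ∑[ j < n ] f (a i , b j)
  fold-product f {zero} a b = ≈-refl
  fold-product f {suc m} a b =
    ≈-trans (fold-++ f (map (a zero ,_) (tabulate b)) _)
            (∙-cong (fold-row f (a zero ,_) b) (fold-product f (a ∘ suc) b))

  upper : {n : ℕ} → (Fin n → Fin n → Carrier) → Fin n → Fin n → Carrier
  upper w i j = if toℕ i <ᵇ toℕ j then w i j else ε

  fold-pairs : {n : ℕ} (w : Fin n → Fin n → Carrier) →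
               fold (map (λ p → w (proj₁ p) (proj₂ p)) (pairs n)) ≈ ∑[ i < n ] ∑[ j < n ] upper w i j
  fold-pairs {n} w =
    ≈-trans (fold-filter (λ p → toℕ (proj₁ p) <? toℕ (proj₂ p)) (λ p → w (proj₁ p) (proj₂ p))
                         (cartesianProduct (tabulate id) (tabulate id)))
            (fold-product (λ p → upper w (proj₁ p) (proj₂ p)) {n} {n} id id)

  -- The diagonal carries the neutral element, so a fold over all ordered pairs meets each unordered
  -- pair exactly twice and nothing else.
  symmetrise : {n : ℕ} → (Fin n → Fin n → Carrier) → Fin n → Fin n → Carrier
  symmetrise w i j = if toℕ i <ᵇ toℕ j then w i j else (if toℕ j <ᵇ toℕ i then w j i else ε)

  symmetrise-split : {n : ℕ} (w : Fin n → Fin n → Carrier) (i j : Fin n) →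
                     symmetrise w i j ≈ upper w i j ∙ upper w j i
  symmetrise-split w zero zero = ≈-sym (identityˡ _)
  symmetrise-split w zero (suc j) = ≈-sym (identityʳ _)
  symmetrise-split w (suc i) zero = ≈-sym (identityˡ _)
  symmetrise-split w (suc i) (suc j) = symmetrise-split (λ x y → w (suc x) (suc y)) i j

  -- The entries below the diagonal are the transpose of those above it, and exchanging the two
  -- folds makes both halves equal. Doubling removes the condition `i < j` from all later counting.
  fold-pairs-square : {n : ℕ} (w : Fin n → Fin n → Carrier) →
    let p = fold (map (λ p → w (proj₁ p) (proj₂ p)) (pairs n)) in
    ∑[ i < n ] ∑[ j < n ] symmetrise w i j ≈ p ∙ p
  fold-pairs-square {n} w =
    ≈-trans (sum-cong-≋ (λ i → ≈-trans (sum-cong-≋ (symmetrise-split w i))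
                                       (∑-distrib-+ (upper w i) (λ j → upper w j i))))
    (≈-trans (∑-distrib-+ (λ i → ∑[ j < n ] upper w i j) (λ i → ∑[ j < n ] upper w j i))
    (∙-cong (≈-sym (fold-pairs w)) (≈-trans (≈-sym (∑-comm (upper w))) (≈-sym (fold-pairs w)))))

  symmetrise-comm : {n : ℕ} (w : Fin n → Fin n → Carrier) (i j : Fin n) →
                    symmetrise w i j ≡ symmetrise w j i
  symmetrise-comm w zero zero = refl
  symmetrise-comm w zero (suc j) = refl
  symmetrise-comm w (suc i) zero = refl
  symmetrise-comm w (suc i) (suc j) = symmetrise-comm (λ x y → w (suc x) (suc y)) i j

  symmetrise-diag : {n : ℕ} (w : Fin n → Fin n → Carrier) (i : Fin n) → symmetrise w i i ≡ ε
  symmetrise-diag w zero = refl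
  symmetrise-diag w (suc i) = symmetrise-diag (λ x y → w (suc x) (suc y)) i

open import Algebra.Properties.CommutativeMonoid.Sum *-1-commutativeMonoid
  using () renaming (sum to ∏; sum-cong-≗ to ∏-cong; ∑-distrib-+ to ∏-distrib-*; ∑-comm to ∏-comm;
                     sum-remove to ∏-remove)
open import Algebra.Properties.Semiring.Sum +-*-semiring
  using (sum-cong-≗; *-distribˡ-sum) renaming (sum to ∑; ∑-distrib-+ to ∑-distrib)

module ⊕ = PairFold +-0-commutativeMonoid
module ⊗ = PairFold *-1-commutativeMonoid

∑-mono : {n : ℕ} {f g : Fin n → ℕ} → (∀ i → f i ≤ g i) → ∑ f ≤ ∑ g
∑-mono {zero} _ = z≤n
∑-mono {suc n} h = +-mono-≤ (h zero) (∑-mono (h ∘ suc))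

∏-mono : {n : ℕ} {f g : Fin n → ℕ} → (∀ i → f i ≤ g i) → ∏ f ≤ ∏ g
∏-mono {zero} _ = ≤-refl
∏-mono {suc n} h = *-mono-≤ (h zero) (∏-mono (h ∘ suc))

∑-zero : (n : ℕ) → ∑ {n} (λ _ → 0) ≡ 0
∑-zero zero = refl
∑-zero (suc n) = ∑-zero n

∑-one : (n : ℕ) → ∑ {n} (λ _ → 1) ≡ n
∑-one zero = refl
∑-one (suc n) = cong suc (∑-one n)

-- Off-diagonal entries do not depend on which neutral element fills the diagonal.
⊗⇒⊕ : {n : ℕ} (w : Multigraph n) (i j : Fin n) → ⊗.symmetrise w i j ≢ 1 →
      ⊕.symmetrise w i j ≡ ⊗.symmetrise w i j
⊗⇒⊕ w i j ≢1 with toℕ i <ᵇ toℕ j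
... | true = refl
... | false with toℕ j <ᵇ toℕ i
...   | true = refl
...   | false with () ← ≢1 refl

P² : {n : ℕ} (w : Multigraph n) → ∏ (λ i → ∏ (⊗.symmetrise w i)) ≡ P w * P w
P² w = ⊗.fold-pairs-square w

-- Spans as double sums with indicator functions.

restrict : {n : ℕ} → Subset n → Multigraph n → Multigraph n
restrict S w i j = if lookup S i ∧ lookup S j then w i j else 0

does-∈? : {n : ℕ} (i : Fin n) (S : Subset n) → does (i ∈? S) ≡ lookup S i
does-∈? zero (true ∷ S) = refl
does-∈? zero (false ∷ S) = refl
does-∈? (suc i) (_ ∷ S) = does-∈? i S

span-restrict : {n : ℕ} (w : Multigraph n) (S : Subset n) →
                span w S ≡ ⊕.fold (map (λ p → restrict S w (proj₁ p) (proj₂ p)) (pairs n))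
span-restrict {n} w S = 
  trans (⊕.fold-filter (λ p → (proj₁ p ∈? S) ×-dec (proj₂ p ∈? S)) (λ p → w (proj₁ p) (proj₂ p)) (pairs n))
        (cong-map (pairs n))
  where
  cong-map : ∀ ps → ⊕.fold (map (λ p → if does ((proj₁ p ∈? S) ×-dec (proj₂ p ∈? S))
                                       then w (proj₁ p) (proj₂ p) else 0) ps) ≡ ⊕.fold (map (λ p → restrict S w (proj₁ p) (proj₂ p)) ps)
  cong-map [] = refl
  cong-map ((i , j) ∷ ps) =
    cong₂ (λ b → (if b then w i j else 0) +_) (cong₂ _∧_ (does-∈? i S) (does-∈? j S)) (cong-map ps)

bit : Bool → ℕ
bit true = 1
bit false = 0

symmetrise-restrict : {n : ℕ} (S : Subset n) (w : Multigraph n) (i j : Fin n) →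
  ⊕.symmetrise (restrict S w) i j ≡ bit (lookup S i) * (bit (lookup S j) * ⊕.symmetrise w i j)
symmetrise-restrict S w i j with toℕ i <ᵇ toℕ j
... | true with lookup S i | lookup S j
...   | true | true = sym (trans (*-identityˡ _) (*-identityˡ _))
...   | true | false = refl
...   | false | true = refl
...   | false | false = refl
symmetrise-restrict S w i j | false with toℕ j <ᵇ toℕ i
... | true with lookup S i | lookup S j
...   | true | true = sym (trans (*-identityˡ _) (*-identityˡ _))
...   | true | false = refl
...   | false | true = refl
...   | false | false = refl
symmetrise-restrict S w i j | false | false = sym (trans (cong (bit (lookup S i) *_) (*-zeroʳ (bit (lookup S j)))) (*-zeroʳ (bit (lookup S i))))

span-double : {n : ℕ} (w : Multigraph n) (S : Subset n) →
  ∑ (λ i → bit (lookup S i) * ∑ (λ j → bit (lookup S j) * ⊕.symmetrise w i j)) ≡ span w S + span w S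
span-double w S = begin
  ∑ (λ i → bit (lookup S i) * ∑ (λ j → bit (lookup S j) * ⊕.symmetrise w i j))
    ≡⟨ sum-cong-≗ (λ i → trans (*-distribˡ-sum (bit (lookup S i)) (λ j → bit (lookup S j) * ⊕.symmetrise w i j))
                               (sum-cong-≗ (λ j → sym (symmetrise-restrict S w i j)))) ⟩
  ∑ (λ i → ∑ (⊕.symmetrise (restrict S w) i))
    ≡⟨ ⊕.fold-pairs-square (restrict S w) ⟩
  _ ≡⟨ sym (cong₂ _+_ (span-restrict w S) (span-restrict w S)) ⟩
  span w S + span w S ∎
  where open ≡-Reasoning

-- Graphs with weights 1, 2, 3 and their local conditions.

data Weight : Set where
  one two three : Weight

val : Weight → ℕ
val one = 1
val two = 2
val three = 3

-- The last clause also catches 0 and numbers above 3; `val-weight` excludes them.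
weight : ℕ → Weight
weight 1 = one
weight 2 = two
weight _ = three

Graph : ℕ → Set
Graph n = Fin n → Fin n → Weight

-- Vertices may coincide here: a repeated vertex either puts weight 1 where weight 3 is assumed or
-- makes the conclusion true. This is what lets `pullback-good` accept maps that identify vertices.
record Good {n : ℕ} (K : Graph n) : Set where
  field
    symmetric : ∀ x y → K x y ≡ K y x
    diagonal  : ∀ x → K x x ≡ one
    triangle  : ∀ {x y z} → K x y ≡ three → K y z ≡ three → K x z ≢ three
    square    : ∀ {x y z t} → K x y ≡ three → K y z ≡ three → K z t ≡ three → K t x ≡ three →
                K x z ≡ one ⊎ K y t ≡ one

pullback : {m n : ℕ} → (Fin m → Fin n) → Graph n → Graph m
pullback f K x y = K (f x) (f y)

pullback-good : {m n : ℕ} (f : Fin m → Fin n) {K : Graph n} → Good K → Good (pullback f K)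
pullback-good f g = record
  { symmetric = λ x y → symmetric (f x) (f y)
  ; diagonal  = λ x → diagonal (f x)
  ; triangle  = triangle
  ; square    = square
  }
  where open Good g

-- Spans of explicitly listed vertices.

points : {n : ℕ} → List (Fin n) → Subset n
points [] = Subset.⊥
points (x ∷ xs) = points xs [ x ]≔ true

lookup-points : {n : ℕ} {x : Fin n} (xs : List (Fin n)) → All (x ≢_) xs → lookup (points xs) x ≡ false
lookup-points {x = x} [] [] = lookup-replicate x false
lookup-points {x = x} (y ∷ xs) (x≢y ∷ x∉xs) =
  trans (lookup∘updateAt′ x y x≢y (points xs)) (lookup-points xs x∉xs)

card-insert : {n : ℕ} (S : Subset n) (x : Fin n) → lookup S x ≡ false → ∣ S [ x ]≔ true ∣ ≡ suc ∣ S ∣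
card-insert (false ∷ S) zero _ = refl
card-insert (true ∷ S) (suc x) h = cong suc (card-insert S x h)
card-insert (false ∷ S) (suc x) h = card-insert S x h

sum-insert : {n : ℕ} (g : Fin n → ℕ) (S : Subset n) (x : Fin n) → lookup S x ≡ false →
  ∑ (λ i → bit (lookup (S [ x ]≔ true) i) * g i) ≡ g x + ∑ (λ i → bit (lookup S i) * g i)
sum-insert g (false ∷ S) zero _ = cong (_+ ∑ (λ i → bit (lookup S i) * g (suc i))) (*-identityˡ (g zero))
sum-insert g (s ∷ S) (suc x) h = begin
  bit s * g zero + ∑ (λ i → bit (lookup (S [ x ]≔ true) i) * g (suc i))
    ≡⟨ cong (bit s * g zero +_) (sum-insert (g ∘ suc) S x h) ⟩
  bit s * g zero + (g (suc x) + ∑ (λ i → bit (lookup S i) * g (suc i)))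
    ≡⟨ swap (bit s * g zero) (g (suc x)) _ ⟩
  g (suc x) + (bit s * g zero + ∑ (λ i → bit (lookup S i) * g (suc i))) ∎
  where
  open ≡-Reasoning
  swap : ∀ a b c → a + (b + c) ≡ b + (a + c)
  swap = solve-∀

card-points : {n : ℕ} (xs : List (Fin n)) → AllPairs _≢_ xs → ∣ points xs ∣ ≡ length xs
card-points {n} [] [] = card-⊥ n
  where
  card-⊥ : ∀ n → ∣ Subset.⊥ {n} ∣ ≡ 0
  card-⊥ zero = refl
  card-⊥ (suc n) = card-⊥ n
card-points (x ∷ xs) (x∉xs ∷ u) =
  trans (card-insert (points xs) x (lookup-points xs x∉xs)) (cong suc (card-points xs u))

sum-points : {n : ℕ} (g : Fin n → ℕ) (xs : List (Fin n)) → AllPairs _≢_ xs →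
             ∑ (λ i → bit (lookup (points xs) i) * g i) ≡ sum (map g xs)
sum-points g [] [] = sum-⊥ g
  where
  sum-⊥ : ∀ {n} (g : Fin n → ℕ) → ∑ (λ i → bit (lookup (Subset.⊥ {n}) i) * g i) ≡ 0
  sum-⊥ {zero} g = refl
  sum-⊥ {suc n} g = sum-⊥ (g ∘ suc)
sum-points g (x ∷ xs) (x∉xs ∷ u) =
  trans (sum-insert g (points xs) x (lookup-points xs x∉xs)) (cong (g x +_) (sum-points g xs u))

span-points : {n : ℕ} (w : Multigraph n) (xs : List (Fin n)) → AllPairs _≢_ xs →
  span w (points xs) + span w (points xs) ≡ sum (map (λ x → sum (map (⊕.symmetrise w x) xs)) xs)
span-points w xs u = begin
  span w S + span w S
    ≡⟨ sym (span-double w S) ⟩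
  ∑ (λ i → bit (lookup S i) * ∑ (λ j → bit (lookup S j) * ⊕.symmetrise w i j))
    ≡⟨ sum-cong-≗ (λ i → cong (bit (lookup S i) *_) (sum-points (⊕.symmetrise w i) xs u)) ⟩
  ∑ (λ i → bit (lookup S i) * sum (map (⊕.symmetrise w i) xs))
    ≡⟨ sum-points (λ i → sum (map (⊕.symmetrise w i) xs)) xs u ⟩
  sum (map (λ x → sum (map (⊕.symmetrise w x) xs)) xs) ∎
  where
  open ≡-Reasoning
  S = points xs

-- From members of `D` to good graphs.

∈-pairs : {n : ℕ} {i j : Fin n} → toℕ i < toℕ j → (i , j) ∈ pairs n
∈-pairs {i = i} {j} = ∈-filter⁺ (λ p → toℕ (proj₁ p) <? toℕ (proj₂ p))
                                (∈-cartesianProduct⁺ (∈-allFin i) (∈-allFin j))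

≤-maximum : {A : Set} (f : A → ℕ) {x : A} {xs : List A} → x ∈ xs → f x ≤ foldr _⊔_ 0 (map f xs)
≤-maximum f (here refl) = m≤m⊔n _ _
≤-maximum f (there x∈xs) = ≤-trans (≤-maximum f x∈xs) (m≤n⊔m _ _)

maximum-≤ : {A : Set} (f : A → ℕ) (b : ℕ) (xs : List A) → (∀ x → f x ≤ b) → foldr _⊔_ 0 (map f xs) ≤ b
maximum-≤ f b [] h = z≤n
maximum-≤ f b (x ∷ xs) h = ⊔-lub (h x) (maximum-≤ f b xs h)

factor-positive : {A : Set} (f : A → ℕ) {x : A} {xs : List A} → x ∈ xs →
                  product (map f xs) ≢ 0 → f x ≢ 0
factor-positive f {xs = _ ∷ xs} (here refl) p≢0 fx≡0 = p≢0 (cong (_* product (map f xs)) fx≡0)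
factor-positive f {xs = y ∷ _} (there x∈xs) p≢0 =
  factor-positive f x∈xs (λ p≡0 → p≢0 (trans (cong (f y *_) p≡0) (*-zeroʳ (f y))))

val-weight : ∀ {k} → k ≢ 0 → k ≤ 3 → val (weight k) ≡ k
val-weight {zero} k≢0 _ = ⊥-elim (k≢0 refl)
val-weight {1} _ _ = refl
val-weight {2} _ _ = refl
val-weight {3} _ _ = refl
val-weight {suc (suc (suc (suc _)))} _ (s≤s (s≤s (s≤s ())))

graph : {n : ℕ} → Multigraph n → Graph n
graph w i j = weight (⊗.symmetrise w i j)

module _ {A : Set} (M : A → A → ℕ) (comm : ∀ x y → M x y ≡ M y x) (diag : ∀ x → M x x ≡ 0) where

  triangle-sum : ∀ x y z → M x y ≡ 3 → M y z ≡ 3 → M x z ≡ 3 →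
    let xs = x ∷ y ∷ z ∷ [] in sum (map (λ x → sum (map (M x) xs)) xs) ≡ 18
  triangle-sum x y z xy yz xz
    rewrite diag x | diag y | diag z | comm y x | comm z x | comm z y | xy | yz | xz = refl

  -- Four sides of weight 3 and two diagonals of weight 2 make 16, counted twice.
  square-sum : ∀ x y z t → M x y ≡ 3 → M y z ≡ 3 → M z t ≡ 3 → M x t ≡ 3 → M x z ≡ 2 → M y t ≡ 2 →
    let xs = x ∷ y ∷ z ∷ t ∷ [] in sum (map (λ x → sum (map (M x) xs)) xs) ≡ 32
  square-sum x y z t xy yz zt xt xz yt
    rewrite diag x | diag y | diag z | diag t
          | comm y x | comm z x | comm t x | comm z y | comm t y | comm t z
          | xy | yz | zt | xt | xz | yt = refl

-- `off-diagonal` leaves out the entries `one` because the diagonal is 1 in `K` but 0 in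
-- `⊕.symmetrise H`. The same convention yields distinctness: vertices joined by another weight
-- differ.
module _ {n : ℕ} (H : Multigraph n) (inD : InD H) (K : Graph n)
         (sym-K : ∀ x y → K x y ≡ K y x) (diag-K : ∀ x → K x x ≡ one)
         (off-diagonal : ∀ x y → K x y ≢ one → ⊕.symmetrise H x y ≡ val (K x y)) where

  private
    entry : ∀ {x y u} → K x y ≡ u → u ≢ one → ⊕.symmetrise H x y ≡ val u
    entry {x} {y} refl u≢one = off-diagonal x y u≢one

    apart : ∀ {x y u} → K x y ≡ u → u ≢ one → x ≢ y
    apart Kxy u≢one refl = u≢one (trans (sym Kxy) (diag-K _))

    tri : ∀ {x y z} → K x y ≡ three → K y z ≡ three → K x z ≢ three
    -- A triangle of weight 3 spans 9, so twice its span is 18, and the comparison of 18 with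
    -- `8 + 8` computes to the empty type.
    tri {x} {y} {z} xy yz xz = ≤⇒≤ᵇ (≤-trans (≤-reflexive (sym double)) (+-mono-≤ bound bound))
      where
      xs = x ∷ y ∷ z ∷ []
      distinct : AllPairs _≢_ xs
      distinct = (apart xy (λ ()) ∷ apart xz (λ ()) ∷ []) ∷ (apart yz (λ ()) ∷ []) ∷ [] ∷ []
      bound : span H (points xs) ≤ 8
      bound = proj₂ (proj₂ inD) (points xs) (card-points xs distinct)
      double : span H (points xs) + span H (points xs) ≡ 18
      double = trans (span-points H xs distinct)
        (triangle-sum (⊕.symmetrise H) (⊕.symmetrise-comm H) (⊕.symmetrise-diag H) x y z
          (entry xy (λ ())) (entry yz (λ ())) (entry xz (λ ())))

    sqr : ∀ {x y z t} → K x y ≡ three → K y z ≡ three → K z t ≡ three → K t x ≡ three →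
          K x z ≡ one ⊎ K y t ≡ one
    sqr {x} {y} {z} {t} xy yz zt tx with K x z in xz | K y t in yt
    ... | one | _ = inj₁ refl
    ... | two | one = inj₂ refl
    -- A diagonal of weight 3 closes a triangle with two sides of the cycle. With both diagonals of
    -- weight 2 the span is 16, above 15.
    ... | three | _ = ⊥-elim (tri {x} {y} {z} xy yz xz)
    ... | two | three = ⊥-elim (tri {y} {z} {t} yz zt yt)
    ... | two | two = ⊥-elim (≤⇒≤ᵇ (≤-trans (≤-reflexive (sym double)) (+-mono-≤ bound bound)))
      where
      xs = x ∷ y ∷ z ∷ t ∷ []
      xt = trans (sym-K x t) tx
      distinct : AllPairs _≢_ xs
      distinct = (apart xy (λ ()) ∷ apart xz (λ ()) ∷ apart xt (λ ()) ∷ [])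
               ∷ (apart yz (λ ()) ∷ apart yt (λ ()) ∷ []) ∷ (apart zt (λ ()) ∷ []) ∷ [] ∷ []
      bound : span H (points xs) ≤ 15
      bound = proj₁ inD (points xs) (card-points xs distinct)
      double : span H (points xs) + span H (points xs) ≡ 32
      double = trans (span-points H xs distinct)
        (square-sum (⊕.symmetrise H) (⊕.symmetrise-comm H) (⊕.symmetrise-diag H) x y z t
          (entry xy (λ ())) (entry yz (λ ())) (entry zt (λ ())) (entry xt (λ ()))
          (entry xz (λ ())) (entry yt (λ ())))

  good-if-D : Good K
  good-if-D = record { symmetric = sym-K ; diagonal = diag-K ; triangle = tri ; square = sqr }

module FromD {n : ℕ} (H : Multigraph n) (inD : InD H) (P≢0 : P H ≢ 0) where

  private
    edge : ∀ {i j} → T (toℕ i <ᵇ toℕ j) → H i j ≢ 0 × H i j ≤ 3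
    edge i<j = factor-positive (λ p → H (proj₁ p) (proj₂ p)) i,j∈pairs P≢0
             , ≤-trans (≤-maximum (λ p → H (proj₁ p) (proj₂ p)) i,j∈pairs) (proj₁ (proj₂ inD))
      where i,j∈pairs = ∈-pairs (<ᵇ⇒< _ _ i<j)

    -- A nonzero product has no zero factor, and `μ` bounds each weight by 3; the diagonal entry is
    -- 1.
    range : ∀ i j → ⊗.symmetrise H i j ≢ 0 × ⊗.symmetrise H i j ≤ 3
    range i j with toℕ i <ᵇ toℕ j in i<j
    ... | true = edge (subst T (sym i<j) _)
    ... | false with toℕ j <ᵇ toℕ i in j<i
    ...   | true = edge (subst T (sym j<i) _)
    ...   | false = (λ ()) , s≤s z≤n

  val-graph : ∀ i j → val (graph H i j) ≡ ⊗.symmetrise H i j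
  val-graph i j = val-weight (proj₁ (range i j)) (proj₂ (range i j))

  graph-good : Good (graph H)
  graph-good = good-if-D H inD (graph H)
    (λ x y → cong weight (⊗.symmetrise-comm H x y))
    (λ x → cong weight (⊗.symmetrise-diag H x))
    (λ x y ≢one → trans (⊗⇒⊕ H x y (λ e → ≢one (cong weight e))) (sym (val-graph x y)))

-- Members of `W` lie in `D`.

blow : {n : ℕ} → Subset n → Multigraph n
blow L i j = crossW (lookup L i) (lookup L j)

blow-inW : {n : ℕ} (L : Subset n) → InW (blow L)
blow-inW L = L , λ i j i<j → refl

crossW≤3 : ∀ b c → crossW b c ≤ 3
crossW≤3 true true = s≤s z≤n
crossW≤3 true false = ≤-refl
crossW≤3 false true = ≤-refl
crossW≤3 false false = s≤s (s≤s z≤n)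

inside outside : {n : ℕ} → Subset n → Subset n → ℕ
inside [] [] = 0
inside (b ∷ L) (s ∷ S) = bit (b ∧ s) + inside L S
outside [] [] = 0
outside (b ∷ L) (s ∷ S) = bit (not b ∧ s) + outside L S

card-split : {n : ℕ} (L S : Subset n) → inside L S + outside L S ≡ ∣ S ∣
card-split [] [] = refl
card-split (true ∷ L) (true ∷ S) = cong suc (card-split L S)
card-split (true ∷ L) (false ∷ S) = card-split L S
card-split (false ∷ L) (true ∷ S) = trans (+-suc _ _) (cong suc (card-split L S))
card-split (false ∷ L) (false ∷ S) = card-split L S

row-sum : {n : ℕ} (b : Bool) (L S : Subset n) →
  ∑ (λ j → if lookup S j then crossW b (lookup L j) else 0)
    ≡ crossW b true * inside L S + crossW b false * outside L S
row-sum b [] [] = sym (cong₂ _+_ (*-zeroʳ (crossW b true)) (*-zeroʳ (crossW b false)))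
row-sum b (c ∷ L) (false ∷ S) with c
... | true = row-sum b L S
... | false = row-sum b L S
row-sum b (true ∷ L) (true ∷ S) =
  trans (cong (crossW b true +_) (row-sum b L S)) (ring (crossW b true) (crossW b false) _ _)
  where
  ring : ∀ c d p q → c + (c * p + d * q) ≡ c * (1 + p) + d * q
  ring = solve-∀
row-sum b (false ∷ L) (true ∷ S) =
  trans (cong (crossW b false +_) (row-sum b L S)) (ring (crossW b true) (crossW b false) _ _)
  where
  ring : ∀ c d p q → d + (c * p + d * q) ≡ c * p + d * (1 + q)
  ring = solve-∀

-- The span is p(p-1)/2 + q(q-1) + 3pq. Doubling it and moving the negative terms to the left gives
-- an identity without subtraction, proved by peeling off the first vertex, whose row `row-sum`
-- evaluates.
span-blow : {n : ℕ} (L S : Subset n) → let p = inside L S; q = outside L S in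
  2 * span (blow L) S + (p + 2 * q) ≡ p * p + 2 * (q * q) + 6 * (p * q)
span-blow L S rewrite trans (span-restrict (blow L) S) (⊕.fold-pairs (restrict S (blow L))) = go L S
  where
  spanned : {n : ℕ} (L S : Subset n) → ℕ
  spanned L S = ∑ (λ i → ∑ (⊕.upper (restrict S (blow L)) i))
  go : {n : ℕ} (L S : Subset n) → let p = inside L S; q = outside L S in
    2 * spanned L S + (p + 2 * q) ≡ p * p + 2 * (q * q) + 6 * (p * q)
  go [] [] = refl
  go {suc n} (b ∷ L) (false ∷ S) with b
  ... | true  rewrite ∑-zero n = go L S
  ... | false rewrite ∑-zero n = go L S
  go (true ∷ L) (true ∷ S) rewrite row-sum true L S =
    trans (ring (spanned L S) (inside L S) (outside L S))
      (trans (cong (_+ (1 + 2 * inside L S + 6 * outside L S)) (go L S)) (ring′ (inside L S) (outside L S)))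
    where
    ring : ∀ s p q → 2 * ((1 * p + 3 * q) + s) + ((1 + p) + 2 * q)
                     ≡ 2 * s + (p + 2 * q) + (1 + 2 * p + 6 * q)
    ring = solve-∀
    ring′ : ∀ p q → p * p + 2 * (q * q) + 6 * (p * q) + (1 + 2 * p + 6 * q)
                    ≡ (1 + p) * (1 + p) + 2 * (q * q) + 6 * ((1 + p) * q)
    ring′ = solve-∀
  go (false ∷ L) (true ∷ S) rewrite row-sum false L S =
    trans (ring (spanned L S) (inside L S) (outside L S))
      (trans (cong (_+ (2 + 6 * inside L S + 4 * outside L S)) (go L S)) (ring′ (inside L S) (outside L S)))
    where
    ring : ∀ s p q → 2 * ((3 * p + 2 * q) + s) + (p + 2 * (1 + q))
                     ≡ 2 * s + (p + 2 * q) + (2 + 6 * p + 4 * q)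
    ring = solve-∀
    ring′ : ∀ p q → p * p + 2 * (q * q) + 6 * (p * q) + (2 + 6 * p + 4 * q)
                    ≡ p * p + 2 * ((1 + q) * (1 + q)) + 6 * (p * (1 + q))
    ring′ = solve-∀

-- Reduces a bound on a span to a comparison of numerals, which then holds by computation.
halve : ∀ s b c k → 2 * s + c ≡ k → T (k <ᵇ 2 * suc b + c) → s ≤ b
halve s b c k e h = ≮⇒≥ λ b<s → <⇒≱ (<ᵇ⇒< k _ h)
  (≤-trans (+-monoˡ-≤ c (*-monoʳ-≤ 2 b<s)) (≤-reflexive e))

blow-inD : {n : ℕ} (L : Subset n) → InD (blow L)
blow-inD L = four , maximum-≤ _ 3 (pairs _) (λ p → crossW≤3 (lookup L (proj₁ p)) (lookup L (proj₂ p))) , three′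
  where
  four : IsSQ 4 15 (blow L)
  -- One case for each way of dividing `S` between `L` and `R`; the last two numerals are the values
  -- of `p + 2 * q` and of the right side of `span-blow`. The bound 15 is attained at (1,3) and
  -- (2,2), the bound 8 below at (1,2).
  four S card with inside L S | outside L S | trans (card-split L S) card | span-blow L S
  ... | 0 | .4 | refl | e = halve _ 15 8 32 e _
  ... | 1 | .3 | refl | e = halve _ 15 7 37 e _
  ... | 2 | .2 | refl | e = halve _ 15 6 36 e _
  ... | 3 | .1 | refl | e = halve _ 15 5 29 e _
  ... | 4 | .0 | refl | e = halve _ 15 4 16 e _
  three′ : IsSQ 3 8 (blow L)
  three′ S card with inside L S | outside L S | trans (card-split L S) card | span-blow L S
  ... | 0 | .3 | refl | e = halve _ 8 6 18 e _
  ... | 1 | .2 | refl | e = halve _ 8 5 21 e _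
  ... | 2 | .1 | refl | e = halve _ 8 4 18 e _
  ... | 3 | .0 | refl | e = halve _ 8 3 9 e _

-- Degree products: deleting and cloning vertices.

deg : {n : ℕ} → Graph n → Fin n → ℕ
deg K u = ∏ (λ y → val (K u y))

-- Each unordered pair is counted twice, so Q is the square of the product P.
Q : {n : ℕ} → Graph n → ℕ
Q K = ∏ (deg K)

val≥1 : ∀ u → 1 ≤ val u
val≥1 one = s≤s z≤n
val≥1 two = s≤s z≤n
val≥1 three = s≤s z≤n

∏-ones : (n : ℕ) → ∏ {n} (λ _ → 1) ≡ 1
∏-ones zero = refl
∏-ones (suc n) = trans (+-identityʳ _) (∏-ones n)

∏-positive : {n : ℕ} {f : Fin n → ℕ} → (∀ i → 1 ≤ f i) → 1 ≤ ∏ f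
∏-positive {n} h = ≤-trans (≤-reflexive (sym (∏-ones n))) (∏-mono h)

Q-positive : {n : ℕ} (K : Graph n) → 1 ≤ Q K
Q-positive K = ∏-positive (λ x → ∏-positive (λ y → val≥1 (K x y)))

Q-cong : {n : ℕ} {K K′ : Graph n} → (∀ x y → K x y ≡ K′ x y) → Q K ≡ Q K′
Q-cong h = ∏-cong (λ x → ∏-cong (λ y → cong val (h x y)))

-- The row and the column of `u` split off. They agree by symmetry, and the diagonal weight 1
-- completes the column without its diagonal entry to a full degree.
Q-remove : {n : ℕ} (K : Graph (suc n)) → Good K → (u : Fin (suc n)) →
           Q K ≡ deg K u * deg K u * Q (pullback (punchIn u) K)
Q-remove {n} K good u = begin
  Q K
    ≡⟨ ∏-remove {i = u} (deg K) ⟩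
  deg K u * ∏ (λ x → deg K (punchIn u x))
    ≡⟨ cong (deg K u *_) (∏-cong (λ x → ∏-remove {i = u} (λ y → val (K (punchIn u x) y)))) ⟩
  deg K u * ∏ (λ x → val (K (punchIn u x) u) * deg K′ x)
    ≡⟨ cong (deg K u *_) (∏-distrib-* (λ x → val (K (punchIn u x) u)) (deg K′)) ⟩
  deg K u * (∏ (λ x → val (K (punchIn u x) u)) * Q K′)
    ≡⟨ cong (λ d → deg K u * (d * Q K′)) column ⟩
  deg K u * (deg K u * Q K′)
    ≡⟨ sym (*-assoc (deg K u) _ _) ⟩
  deg K u * deg K u * Q K′ ∎
  where
  open ≡-Reasoning
  open Good good
  K′ = pullback (punchIn u) K
  column : ∏ (λ x → val (K (punchIn u x) u)) ≡ deg K u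
  column = begin
    ∏ (λ x → val (K (punchIn u x) u))
      ≡⟨ ∏-cong (λ x → cong val (symmetric (punchIn u x) u)) ⟩
    ∏ (λ x → val (K u (punchIn u x)))
      ≡⟨ sym (*-identityˡ _) ⟩
    1 * ∏ (λ x → val (K u (punchIn u x)))
      ≡⟨ cong (λ w → val w * ∏ (λ x → val (K u (punchIn u x)))) (sym (diagonal u)) ⟩
    val (K u u) * ∏ (λ x → val (K u (punchIn u x)))
      ≡⟨ sym (∏-remove {i = u} (λ y → val (K u y))) ⟩
    deg K u ∎

redirect : {n : ℕ} → Fin n → Fin n → Fin n → Fin n
redirect u v x = if does (x Fin.≟ u) then v else x

redirect-≡ : {n : ℕ} (u v : Fin n) → redirect u v u ≡ v
redirect-≡ u v with u Fin.≟ u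
... | yes _ = refl
... | no u≢u = ⊥-elim (u≢u refl)

redirect-≢ : {n : ℕ} (u v : Fin n) {x : Fin n} → x ≢ u → redirect u v x ≡ x
redirect-≢ u v {x} x≢u with x Fin.≟ u
... | yes x≡u = ⊥-elim (x≢u x≡u)
... | no _ = refl

-- Replacing `u` by a clone of `v` changes only the factor of `u` in `Q-remove`.
redirect-increases : {n : ℕ} (K : Graph n) → Good K → (u v : Fin n) → K u v ≡ one →
                     deg K u < deg K v → Q K < Q (pullback (redirect u v) K)
redirect-increases {suc n} K good u v uv du<dv = begin-strict
  Q K
    ≡⟨ Q-remove K good u ⟩
  deg K u * deg K u * rest
    <⟨ *-monoˡ-< rest {{>-nonZero (Q-positive (pullback (punchIn u) K))}} (*-mono-< du<dv du<dv) ⟩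
  deg K v * deg K v * rest
    ≡⟨ cong₂ (λ d r → d * d * r) (sym degree) (sym same-rest) ⟩
  deg K′ u * deg K′ u * Q (pullback (punchIn u) K′)
    ≡⟨ sym (Q-remove K′ (pullback-good (redirect u v) good) u) ⟩
  Q K′ ∎
  where
  open ≤-Reasoning
  open Good good
  f = redirect u v
  K′ = pullback f K
  rest = Q (pullback (punchIn u) K)
  -- Here `K u v ≡ one` enters: the clone is joined to `v` by weight 1, just as `u` was, so its
  -- degree is the old degree of `v`.
  row : ∀ y → K v (f y) ≡ K v y
  row y with y Fin.≟ u
  ... | yes refl = trans (diagonal v) (trans (sym uv) (symmetric u v))
  ... | no _ = refl
  degree : deg K′ u ≡ deg K v
  degree = ∏-cong (λ y → cong val (trans (cong (λ w → K w (f y)) (redirect-≡ u v)) (row y)))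
  same-rest : Q (pullback (punchIn u) K′) ≡ rest
  same-rest = Q-cong (λ x y → cong₂ K (redirect-≢ u v (Fin.punchInᵢ≢i u x)) (redirect-≢ u v (Fin.punchInᵢ≢i u y)))

ifOne ifNotOne : Weight → ℕ → ℕ
ifOne one k = k
ifOne _ k = 1
ifNotOne one k = 1
ifNotOne _ k = k

absorb : {n : ℕ} → Graph n → Fin n → Fin n → Fin n
absorb K v x with K v x
... | one = v
... | _   = x

absorb-one : {n : ℕ} (K : Graph n) (v x : Fin n) → K v x ≡ one → absorb K v x ≡ v
absorb-one K v x vx with one ← K v x = refl

module Absorb {n : ℕ} (K : Graph n) (good : Good K) (v : Fin n) where
  open Good good

  absorbed : Graph n
  absorbed = pullback (absorb K v) K

  absorbed-good : Good absorbed
  absorbed-good = pullback-good (absorb K v) good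

  -- Only 1-neighbours of `v` move, and they move to `v`, which has weight 1 to itself. In
  -- particular the number of 1-neighbours of `v` survives.
  row-v : ∀ x → absorbed v x ≡ K v x
  row-v x rewrite absorb-one K v v (diagonal v) with K v x in vx
  ... | one = diagonal v
  ... | two = vx
  ... | three = vx

  twins : ∀ x y → absorbed v x ≡ one → absorbed x y ≡ absorbed v y
  twins x y vx = cong (λ z → K z (absorb K v y))
    (trans (absorb-one K v x (trans (sym (row-v x)) vx)) (sym (absorb-one K v v (diagonal v))))

  star : Graph n → Fin n → Fin n → ℕ
  star R x y = ifOne (K v x) (val (R x y))

  rest : Fin n → Fin n → ℕ
  rest x y = ifNotOne (K v x) (ifNotOne (K v y) (val (K x y)))

  -- A pair inside the 1-neighbourhood of `v` is charged to both of its ends, which only increases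
  -- the product because weights are at least 1.
  split-≤ : ∀ x y → val (K x y) ≤ star K x y * (star K y x * rest x y)
  split-≤ x y with K v x | K v y
  ... | one | one = ≤-trans (≤-reflexive (sym (*-identityʳ _)))
          (*-monoʳ-≤ (val (K x y)) (≤-trans (val≥1 (K y x)) (≤-reflexive (sym (*-identityʳ _)))))
  ... | one | two = ≤-reflexive (sym (*-identityʳ _))
  ... | one | three = ≤-reflexive (sym (*-identityʳ _))
  ... | two | one rewrite symmetric x y = ≤-reflexive (sym (trans (*-identityˡ _) (*-identityʳ _)))
  ... | three | one rewrite symmetric x y = ≤-reflexive (sym (trans (*-identityˡ _) (*-identityʳ _)))
  ... | two | two = ≤-reflexive (sym (trans (*-identityˡ _) (*-identityˡ _)))
  ... | two | three = ≤-reflexive (sym (trans (*-identityˡ _) (*-identityˡ _)))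
  ... | three | two = ≤-reflexive (sym (trans (*-identityˡ _) (*-identityˡ _)))
  ... | three | three = ≤-reflexive (sym (trans (*-identityˡ _) (*-identityˡ _)))

  -- Once all rows in the 1-neighbourhood are the row of `v`, double charging is harmless: pairs
  -- inside have weight 1.
  split-≡ : ∀ x y → star (λ _ → K v) x y * (star (λ _ → K v) y x * rest x y) ≡ val (absorbed x y)
  split-≡ x y with K v x in vx | K v y in vy
  ... | one | one rewrite diagonal v = refl
  ... | one | two rewrite vy = refl
  ... | one | three rewrite vy = refl
  ... | two | one rewrite symmetric x v | vx = refl
  ... | three | one rewrite symmetric x v | vx = refl
  ... | two | two = trans (*-identityˡ _) (*-identityˡ _)
  ... | two | three = trans (*-identityˡ _) (*-identityˡ _)
  ... | three | two = trans (*-identityˡ _) (*-identityˡ _)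
  ... | three | three = trans (*-identityˡ _) (*-identityˡ _)

  ∏∏ : (Fin n → Fin n → ℕ) → ℕ
  ∏∏ f = ∏ (λ x → ∏ (f x))

  ∏∏-split : ∀ f g → ∏∏ (λ x y → f x y * (f y x * g x y)) ≡ ∏∏ f * (∏∏ f * ∏∏ g)
  ∏∏-split f g = begin
    ∏∏ (λ x y → f x y * (f y x * g x y))
      ≡⟨ ∏-cong (λ x → trans (∏-distrib-* (f x) (λ y → f y x * g x y))
                             (cong (∏ (f x) *_) (∏-distrib-* (λ y → f y x) (g x)))) ⟩
    ∏ (λ x → ∏ (f x) * (∏ (λ y → f y x) * ∏ (g x)))
      ≡⟨ ∏-distrib-* (λ x → ∏ (f x)) (λ x → ∏ (λ y → f y x) * ∏ (g x)) ⟩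
    ∏∏ f * ∏ (λ x → ∏ (λ y → f y x) * ∏ (g x))
      ≡⟨ cong (∏∏ f *_) (∏-distrib-* (λ x → ∏ (λ y → f y x)) (λ x → ∏ (g x))) ⟩
    ∏∏ f * (∏∏ (λ x y → f y x) * ∏∏ g)
      ≡⟨ cong (λ p → ∏∏ f * (p * ∏∏ g)) (∏-comm (λ x y → f y x)) ⟩
    ∏∏ f * (∏∏ f * ∏∏ g) ∎
    where open ≡-Reasoning

  -- Up to the overcount in `split-≤`, `Q K` is the squared product of the degrees of the
  -- 1-neighbours of `v` times a part that absorption keeps. Each such degree is at most `deg K v`.
  absorb-≥ : (∀ x → K v x ≡ one → deg K x ≤ deg K v) → Q K ≤ Q absorbed
  absorb-≥ maximal = begin
    Q K
      ≤⟨ ∏-mono (λ x → ∏-mono (split-≤ x)) ⟩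
    ∏∏ (λ x y → star K x y * (star K y x * rest x y))
      ≡⟨ ∏∏-split (star K) rest ⟩
    ∏∏ (star K) * (∏∏ (star K) * ∏∏ rest)
      ≤⟨ *-mono-≤ stars (*-monoˡ-≤ (∏∏ rest) stars) ⟩
    ∏∏ star′ * (∏∏ star′ * ∏∏ rest)
      ≡⟨ sym (∏∏-split star′ rest) ⟩
    ∏∏ (λ x y → star′ x y * (star′ y x * rest x y))
      ≡⟨ ∏-cong (λ x → ∏-cong (split-≡ x)) ⟩
    Q absorbed ∎
    where
    open ≤-Reasoning
    star′ = star (λ _ → K v)
    row : ∀ x → ∏ (star K x) ≤ ∏ (star′ x)
    row x with K v x in vx
    ... | one = maximal x vx
    ... | two = ≤-refl
    ... | three = ≤-refl
    stars : ∏∏ (star K) ≤ ∏∏ star′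
    stars = ∏-mono row

-- Counting neighbours by weight; vertices of large degree.

isOne isTwo isThree : Weight → ℕ
isOne one = 1
isOne _ = 0
isTwo two = 1
isTwo _ = 0
isThree three = 1
isThree _ = 0

module _ {n : ℕ} (K : Graph n) where
  ones twos threes : Fin n → ℕ
  ones u = ∑ (λ x → isOne (K u x))
  twos u = ∑ (λ x → isTwo (K u x))
  threes u = ∑ (λ x → isThree (K u x))

∑-weights : {n : ℕ} (r : Fin n → Weight) →
            ∑ (isOne ∘ r) + (∑ (isTwo ∘ r) + ∑ (isThree ∘ r)) ≡ n
∑-weights {n} r = begin
  ∑ (isOne ∘ r) + (∑ (isTwo ∘ r) + ∑ (isThree ∘ r))
    ≡⟨ cong (∑ (isOne ∘ r) +_) (sym (∑-distrib (isTwo ∘ r) (isThree ∘ r))) ⟩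
  ∑ (isOne ∘ r) + ∑ (λ x → isTwo (r x) + isThree (r x))
    ≡⟨ sym (∑-distrib (isOne ∘ r) (λ x → isTwo (r x) + isThree (r x))) ⟩
  ∑ (λ x → isOne (r x) + (isTwo (r x) + isThree (r x)))
    ≡⟨ sum-cong-≗ (λ x → exhaust (r x)) ⟩
  ∑ {n} (λ _ → 1)
    ≡⟨ ∑-one n ⟩
  n ∎
  where
  open ≡-Reasoning
  exhaust : ∀ w → isOne w + (isTwo w + isThree w) ≡ 1
  exhaust one = refl
  exhaust two = refl
  exhaust three = refl

∏-val : {n : ℕ} (r : Fin n → Weight) → ∏ (val ∘ r) ≡ 2 ^ ∑ (isTwo ∘ r) * 3 ^ ∑ (isThree ∘ r)
∏-val {zero} r = refl
∏-val {suc n} r with r zero | ∏-val (r ∘ suc)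
... | one | ih = trans (*-identityˡ _) ih
... | two | ih = trans (cong (2 *_) ih) (sym (*-assoc 2 (2 ^ ∑ (isTwo ∘ r ∘ suc)) _))
... | three | ih = trans (cong (3 *_) ih) (rotate (2 ^ ∑ (isTwo ∘ r ∘ suc)) _)
  where
  rotate : ∀ a b → 3 * (a * b) ≡ a * (3 * b)
  rotate = solve-∀

^-distribʳ-* : ∀ a b k → (a * b) ^ k ≡ a ^ k * b ^ k
^-distribʳ-* a b zero = refl
^-distribʳ-* a b (suc k) = trans (cong (a * b *_) (^-distribʳ-* a b k)) (ring a b (a ^ k) (b ^ k))
  where
  ring : ∀ a b c d → a * b * (c * d) ≡ a * c * (b * d)
  ring = solve-∀

^-swap : ∀ a k l → (a ^ k) ^ l ≡ (a ^ l) ^ k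
^-swap a k l = trans (^-*-assoc a k l) (trans (cong (a ^_) (*-comm k l)) (sym (^-*-assoc a l k)))

^-cancel-base-≤ : ∀ k .{{_ : NonZero k}} {a b} → a ^ k ≤ b ^ k → a ≤ b
^-cancel-base-≤ k h = ≮⇒≥ (λ b<a → <⇒≱ (^-monoˡ-< k b<a) h)

^-cancel-exponent-≤ : ∀ {k l} → 2 ^ k ≤ 2 ^ l → k ≤ l
^-cancel-exponent-≤ h = ≮⇒≥ (λ l<k → <⇒≱ (^-monoʳ-< 2 (s≤s (s≤s z≤n)) l<k) h)

-- Logarithms are replaced by integer powers: 3^17 ≤ 2^27 here, and 2^19 ≤ 3^12 in the opposite
-- estimate below.
log₂3≤27/17 : ∀ x y → 2 ^ x ≤ 3 ^ y → 17 * x ≤ 27 * y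
log₂3≤27/17 x y h = ^-cancel-exponent-≤ (begin
  2 ^ (17 * x)   ≡⟨ cong (2 ^_) (*-comm 17 x) ⟩
  2 ^ (x * 17)   ≡⟨ sym (^-*-assoc 2 x 17) ⟩
  (2 ^ x) ^ 17   ≤⟨ ^-monoˡ-≤ 17 h ⟩
  (3 ^ y) ^ 17   ≡⟨ ^-swap 3 y 17 ⟩
  (3 ^ 17) ^ y   ≤⟨ ^-monoˡ-≤ y (≤ᵇ⇒≤ (3 ^ 17) (2 ^ 27) _) ⟩
  (2 ^ 27) ^ y   ≡⟨ ^-*-assoc 2 27 y ⟩
  2 ^ (27 * y)   ∎)
  where open ≤-Reasoning

19/12≤log₂3 : ∀ x y → 12 * x ≤ 19 * y → 2 ^ x ≤ 3 ^ y
19/12≤log₂3 x y h = ^-cancel-base-≤ 12 (begin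
  (2 ^ x) ^ 12   ≡⟨ ^-*-assoc 2 x 12 ⟩
  2 ^ (x * 12)   ≡⟨ cong (2 ^_) (*-comm x 12) ⟩
  2 ^ (12 * x)   ≤⟨ ^-monoʳ-≤ 2 h ⟩
  2 ^ (19 * y)   ≡⟨ sym (^-*-assoc 2 19 y) ⟩
  (2 ^ 19) ^ y   ≤⟨ ^-monoˡ-≤ y (≤ᵇ⇒≤ (2 ^ 19) (3 ^ 12) _) ⟩
  (3 ^ 12) ^ y   ≡⟨ ^-swap 3 12 y ⟩
  (3 ^ y) ^ 12   ∎)
  where open ≤-Reasoning

-- In terms of proportions of n: a vertex whose degree (a product of weights) is at least 2^(37n/32) satisfies
-- threes ≥ 17/64 + (17/10) ones.
Rich : {n : ℕ} → Graph n → Set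
Rich {n} K = ∀ u → 85 * n + 544 * ones K u ≤ 320 * threes K u

-- With n = a + b + c and degree 2^b 3^c, the hypothesis says 37a + 5b + 37c ≤ 32c log₂3. Estimating
-- log₂3 by 27/17 and collecting n gives the constants 85, 544 and 320.
rich-vertex : {n : ℕ} (K : Graph n) (u : Fin n) → 2 ^ (37 * n) ≤ deg K u ^ 32 →
              85 * n + 544 * ones K u ≤ 320 * threes K u
rich-vertex {n} K u h = subst (λ n → 85 * n + 544 * a ≤ 320 * c) (∑-weights (K u)) goal
  where
  a = ones K u
  b = twos K u
  c = threes K u
  -- The contribution of the weight-2 neighbours is isolated on both sides, to be cancelled.
  powers : 2 ^ (37 * a + 5 * b + 37 * c) * 2 ^ (b * 32) ≤ 3 ^ (c * 32) * 2 ^ (b * 32)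
  powers = begin
    2 ^ (37 * a + 5 * b + 37 * c) * 2 ^ (b * 32)
      ≡⟨ sym (^-distribˡ-+-* 2 (37 * a + 5 * b + 37 * c) (b * 32)) ⟩
    2 ^ (37 * a + 5 * b + 37 * c + b * 32)
      ≡⟨ cong (2 ^_) (ring a b c) ⟩
    2 ^ (37 * (a + (b + c)))
      ≡⟨ cong (λ n → 2 ^ (37 * n)) (∑-weights (K u)) ⟩
    2 ^ (37 * n)
      ≤⟨ h ⟩
    deg K u ^ 32
      ≡⟨ cong (_^ 32) (∏-val (K u)) ⟩
    (2 ^ b * 3 ^ c) ^ 32
      ≡⟨ ^-distribʳ-* (2 ^ b) (3 ^ c) 32 ⟩
    (2 ^ b) ^ 32 * (3 ^ c) ^ 32
      ≡⟨ cong₂ _*_ (^-*-assoc 2 b 32) (^-*-assoc 3 c 32) ⟩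
    2 ^ (b * 32) * 3 ^ (c * 32)
      ≡⟨ *-comm (2 ^ (b * 32)) _ ⟩
    3 ^ (c * 32) * 2 ^ (b * 32) ∎
    where
    open ≤-Reasoning
    ring : ∀ a b c → 37 * a + 5 * b + 37 * c + b * 32 ≡ 37 * (a + (b + c))
    ring = solve-∀
  exponents : 17 * (37 * a + 5 * b + 37 * c) ≤ 27 * (c * 32)
  exponents = log₂3≤27/17 (37 * a + 5 * b + 37 * c) (c * 32)
    (*-cancelʳ-≤ (2 ^ (37 * a + 5 * b + 37 * c)) (3 ^ (c * 32)) (2 ^ (b * 32)) {{m^n≢0 2 (b * 32)}} powers)
  goal : 85 * (a + (b + c)) + 544 * a ≤ 320 * c
  goal = +-cancelʳ-≤ (544 * c) _ _
    (≤-trans (≤-reflexive (ring a b c)) (≤-trans exponents (≤-reflexive (ring′ c))))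
    where
    ring : ∀ a b c → 85 * (a + (b + c)) + 544 * a + 544 * c ≡ 17 * (37 * a + 5 * b + 37 * c)
    ring = solve-∀
    ring′ : ∀ c → 27 * (c * 32) ≡ 320 * c + 544 * c
    ring′ = solve-∀

-- Spread neighbours and the largest 1-neighbourhood.

sum-exceeds : {n : ℕ} (f g : Fin n → ℕ) → ∑ g < ∑ f → ∃ λ x → g x < f x
sum-exceeds f g h with any? (λ x → g x <? f x)
... | yes found = found
... | no none = ⊥-elim (<⇒≱ h (∑-mono (λ x → ≮⇒≥ (λ lt → none (x , lt)))))

∑-sum : {n : ℕ} {A : Set} (f : A → Fin n → ℕ) (js : List A) →
        ∑ (λ x → sum (map (λ j → f j x) js)) ≡ sum (map (λ j → ∑ (f j)) js)
∑-sum {n} f [] = ∑-zero n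
∑-sum f (j ∷ js) = trans (∑-distrib (f j) (λ x → sum (map (λ j → f j x) js))) (cong (∑ (f j) +_) (∑-sum f js))

sum-≤ : {A : Set} (f : A → ℕ) (b : ℕ) (js : List A) → (∀ j → f j ≤ b) → sum (map f js) ≤ length js * b
sum-≤ f b [] h = z≤n
sum-≤ f b (j ∷ js) h = +-mono-≤ (h j) (sum-≤ f b js h)

isThree≤1 : ∀ w → isThree w ≤ 1
isThree≤1 one = z≤n
isThree≤1 two = z≤n
isThree≤1 three = ≤-refl

module _ {n : ℕ} {K : Graph n} (good : Good K) where
  open Good good

  -- A spread of neighbours: all joined to v by weight 3, no two of them joined by weight 1.
  Spread : Fin n → List (Fin n) → Set
  Spread v js = All (λ j → K v j ≡ three) js × AllPairs (λ j j′ → K j j′ ≢ one) js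

  -- Greedy choice: the 1-neighbourhoods of `js` are together too small to cover all 3-neighbours of
  -- `v`. An uncovered one can be added, since `isThree` is at most 1 and so its number of 1-edges
  -- to `js` must be 0.
  extend : (v : Fin n) (js : List (Fin n)) → Spread v js →
           sum (map (ones K) js) < threes K v → ∃ λ j → Spread v (j ∷ js)
  extend v js (nbrs , apart) h with sum-exceeds (λ x → isThree (K v x)) (λ x → sum (map (λ j → isOne (K j x)) js))
                                     (subst (_< threes K v) (sym (∑-sum (λ j x → isOne (K j x)) js)) h)
  ... | x , uncovered = x , (three-at (K v x) uncovered refl ∷ nbrs) , (outside-all js (small (K v x) uncovered) ∷ apart)
    where
    three-at : ∀ {k} w → k < isThree w → K v x ≡ w → K v x ≡ three
    three-at three _ e = e
    small : ∀ {k} w → k < isThree w → k ≡ 0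
    small w lt = n<1⇒n≡0 (≤-trans lt (isThree≤1 w))
    outside-all : ∀ js → sum (map (λ j → isOne (K j x)) js) ≡ 0 → All (λ j → K x j ≢ one) js
    outside-all [] _ = []
    outside-all (j ∷ js) e =
      (λ xj → 1+n≢0 (trans (cong (λ w → isOne w + sum (map (λ j → isOne (K j x)) js)) (sym (trans (symmetric j x) xj))) e))
      ∷ outside-all js (m+n≡0⇒n≡0 (isOne (K j x)) e)

  -- No triangle and no bad 4-cycle: the neighbourhoods of a spread of neighbours of v are pairwise
  -- disjoint, and disjoint from that of v, except at the vertices joined to v by weight 1.
  packing : (v : Fin n) (js : List (Fin n)) (k : ℕ) → Spread v js → length js ≤ suc k → ∀ x →
            sum (map (λ j → isThree (K j x)) js) + isThree (K v x) ≤ 1 + k * isOne (K v x)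
  packing v js k (nbrs , apart) len x with K v x in vx
  ... | one = begin
    sum (map (λ j → isThree (K j x)) js) + 0  ≡⟨ +-identityʳ _ ⟩
    sum (map (λ j → isThree (K j x)) js)      ≤⟨ sum-≤ _ 1 js (λ j → isThree≤1 (K j x)) ⟩
    length js * 1                             ≡⟨ *-identityʳ _ ⟩
    length js                                 ≤⟨ len ⟩
    suc k                                     ≡⟨ cong suc (sym (*-identityʳ k)) ⟩
    1 + k * 1                                 ∎
    where open ≤-Reasoning
  ... | three = ≤-trans (≤-reflexive (cong (_+ 1) (none js nbrs))) (s≤s z≤n)
    where
    none : ∀ js → All (λ j → K v j ≡ three) js → sum (map (λ j → isThree (K j x)) js) ≡ 0
    none [] [] = refl
    none (j ∷ js) (vj ∷ nbrs) with K j x in jx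
    ... | one = none js nbrs
    ... | two = none js nbrs
    ... | three = ⊥-elim (triangle vj jx vx)
  ... | two = ≤-trans (≤-reflexive (+-identityʳ _)) (≤-trans (atMostOne js nbrs apart) (s≤s z≤n))
    where
    atMostOne : ∀ js → All (λ j → K v j ≡ three) js → AllPairs (λ j j′ → K j j′ ≢ one) js →
                sum (map (λ j → isThree (K j x)) js) ≤ 1
    atMostOne [] _ _ = z≤n
    atMostOne (j ∷ js) (vj ∷ nbrs) (j-apart ∷ apart) with K j x in jx
    ... | one = atMostOne js nbrs apart
    ... | two = atMostOne js nbrs apart
    ... | three = ≤-reflexive (cong suc (others js nbrs j-apart))
      where
      others : ∀ js → All (λ j → K v j ≡ three) js → All (λ j′ → K j j′ ≢ one) js →
               sum (map (λ j → isThree (K j x)) js) ≡ 0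
      others [] _ _ = refl
      others (j′ ∷ js) (vj′ ∷ nbrs) (jj′ ∷ rest) with K j′ x in j′x
      ... | one = others js nbrs rest
      ... | two = others js nbrs rest
      ... | three with square vj jx (trans (symmetric x j′) j′x) (trans (symmetric j′ v) vj′)
      ...   | inj₁ vx≡one with () ← trans (sym vx) vx≡one
      ...   | inj₂ jj′≡one = ⊥-elim (jj′ jj′≡one)

  packing-sum : (v : Fin n) (js : List (Fin n)) (k : ℕ) → Spread v js → length js ≤ suc k →
                sum (map (threes K) js) + threes K v ≤ n + k * ones K v
  packing-sum v js k spread len = begin
    sum (map (threes K) js) + threes K v
      ≡⟨ cong (_+ threes K v) (sym (∑-sum (λ j x → isThree (K j x)) js)) ⟩
    ∑ (λ x → sum (map (λ j → isThree (K j x)) js)) + threes K v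
      ≡⟨ sym (∑-distrib (λ x → sum (map (λ j → isThree (K j x)) js)) (λ x → isThree (K v x))) ⟩
    ∑ (λ x → sum (map (λ j → isThree (K j x)) js) + isThree (K v x))
      ≤⟨ ∑-mono (packing v js k spread len) ⟩
    ∑ (λ x → 1 + k * isOne (K v x))
      ≡⟨ ∑-distrib (λ _ → 1) (λ x → k * isOne (K v x)) ⟩
    ∑ {n} (λ _ → 1) + ∑ (λ x → k * isOne (K v x))
      ≡⟨ cong₂ _+_ (∑-one n) (sym (*-distribˡ-sum k (λ x → isOne (K v x)))) ⟩
    n + k * ones K v ∎
    where open ≤-Reasoning

  -- Let a be the number of 1-neighbours of `v`. If `v` has at most 3a 3-neighbours, richness of `v`
  -- alone gives 85n + 544a ≤ 960a. Otherwise three chosen neighbours block at most 3a vertices, so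
  -- four spread ones exist, and richness with `packing-sum` gives even 105n ≤ 416a.
  largest-class : Rich K → (v : Fin n) → (∀ x → ones K x ≤ ones K v) → 85 * n ≤ 416 * ones K v
  largest-class rich v maximal with threes K v ≤? 3 * ones K v
  ... | yes few = +-cancelʳ-≤ (544 * a) _ _ (begin
    85 * n + 544 * a    ≤⟨ rich v ⟩
    320 * threes K v    ≤⟨ *-monoʳ-≤ 320 few ⟩
    320 * (3 * a)       ≡⟨ ring a ⟩
    416 * a + 544 * a   ∎)
    where
    open ≤-Reasoning
    a = ones K v
    ring : ∀ a → 320 * (3 * a) ≡ 416 * a + 544 * a
    ring = solve-∀
  ... | no many = four (proj₂ (pick 4 ≤-refl))
    where
    a = ones K v
    covered : ∀ js → length js ≤ 3 → sum (map (ones K) js) < threes K v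
    covered js len =
      ≤-<-trans (sum-≤ (ones K) a js maximal) (≤-<-trans (*-monoˡ-≤ a len) (≰⇒> many))
    pick : ∀ k → k ≤ 4 → ∃ λ js → Spread v js × length js ≡ k
    pick zero _ = [] , ([] , []) , refl
    pick (suc k) k<4 with pick k (≤-trans (n≤1+n k) k<4)
    ... | js , spread , refl with extend v js spread (covered js (s≤s⁻¹ k<4))
    ...   | j , spread′ = j ∷ js , spread′ , refl
    threes-≥ : ∀ js → length js * (85 * n) ≤ 320 * sum (map (threes K) js)
    threes-≥ [] = z≤n
    threes-≥ (j ∷ js) = ≤-trans (+-mono-≤ (≤-trans (m≤m+n (85 * n) _) (rich j)) (threes-≥ js))
                                (≤-reflexive (sym (*-distribˡ-+ 320 (threes K j) _)))
    four : ∀ {js} → Spread v js × length js ≡ 4 → 85 * n ≤ 416 * a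
    four {js} (spread , len) = ≤-trans (*-monoˡ-≤ n (≤ᵇ⇒≤ 85 105 _)) (+-cancelʳ-≤ (320 * n + 544 * a) _ _ (begin
      105 * n + (320 * n + 544 * a)
        ≡⟨ ring n a ⟩
      4 * (85 * n) + (85 * n + 544 * a)
        ≤⟨ +-mono-≤ (subst (λ l → l * (85 * n) ≤ 320 * sum (map (threes K) js)) len (threes-≥ js)) (rich v) ⟩
      320 * sum (map (threes K) js) + 320 * threes K v
        ≡⟨ sym (*-distribˡ-+ 320 (sum (map (threes K) js)) _) ⟩
      320 * (sum (map (threes K) js) + threes K v)
        ≤⟨ *-monoʳ-≤ 320 (packing-sum v js 3 spread (≤-reflexive len)) ⟩
      320 * (n + 3 * a)
        ≡⟨ ring′ n a ⟩
      416 * a + (320 * n + 544 * a) ∎))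
      where
      open ≤-Reasoning
      ring : ∀ n a → 105 * n + (320 * n + 544 * a) ≡ 4 * (85 * n) + (85 * n + 544 * a)
      ring = solve-∀
      ring′ : ∀ n a → 320 * (n + 3 * a) ≡ 416 * a + (320 * n + 544 * a)
      ring′ = solve-∀

  -- Excluding weight 2 at the absorbing vertex.

  disjoint-threes : ∀ {v j} → K v j ≡ three → threes K v + threes K j ≤ n
  disjoint-threes {v} {j} vj = begin
    threes K v + threes K j
      ≡⟨ sym (∑-distrib (λ x → isThree (K v x)) (λ x → isThree (K j x))) ⟩
    ∑ (λ x → isThree (K v x) + isThree (K j x))
      ≤⟨ ∑-mono at ⟩
    ∑ {n} (λ _ → 1)
      ≡⟨ ∑-one n ⟩
    n ∎
    where
    open ≤-Reasoning
    at : ∀ x → isThree (K v x) + isThree (K j x) ≤ 1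
    at x with K v x in vx | K j x in jx
    ... | three | three = ⊥-elim (triangle vj jx vx)
    ... | three | one = ≤-refl
    ... | three | two = ≤-refl
    ... | one | w = isThree≤1 w
    ... | two | w = isThree≤1 w

  module _ (rich : Rich K) (v : Fin n)
           (twins : ∀ x y → K v x ≡ one → K x y ≡ K v y) (large : 85 * n ≤ 416 * ones K v) where

    private
      a = ones K v
      V = threes K v

    module _ {l : Fin n} (vl : K v l ≡ two) where

      shared : Fin n → ℕ
      shared x = isThree (K v x) * isThree (K l x)

      cover : threes K l + (V + a) ≤ n + ∑ shared
      cover = begin
        threes K l + (V + a)
          ≡⟨ cong (threes K l +_) (sym (∑-distrib (λ x → isThree (K v x)) (λ x → isOne (K v x)))) ⟩
        threes K l + ∑ (λ x → isThree (K v x) + isOne (K v x))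
          ≡⟨ sym (∑-distrib (λ x → isThree (K l x)) (λ x → isThree (K v x) + isOne (K v x))) ⟩
        ∑ (λ x → isThree (K l x) + (isThree (K v x) + isOne (K v x)))
          ≤⟨ ∑-mono at ⟩
        ∑ (λ x → 1 + shared x)
          ≡⟨ ∑-distrib (λ _ → 1) shared ⟩
        ∑ {n} (λ _ → 1) + ∑ shared
          ≡⟨ cong (_+ ∑ shared) (∑-one n) ⟩
        n + ∑ shared ∎
        where
        open ≤-Reasoning
        at : ∀ x → isThree (K l x) + (isThree (K v x) + isOne (K v x)) ≤ 1 + shared x
        at x with K v x in vx
        -- A 1-neighbour of `v` is a twin of `v`, so its weight to `l` is that of `v`, namely 2.
        -- Hence only 3-neighbours of `v` can be counted twice.
        ... | one rewrite symmetric l x | twins x l vx | vl = ≤-refl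
        ... | two = ≤-trans (≤-reflexive (+-identityʳ _)) (≤-trans (isThree≤1 (K l x)) (s≤s z≤n))
        ... | three = ≤-reflexive (trans (+-comm (isThree (K l x)) 1) (cong suc (sym (+-identityʳ _))))

      -- The cycle `v`, `j`, `l`, `x` has weight 3 throughout and its diagonal from `v` to `l` has
      -- weight 2, so `j` and `x` are joined by weight 1.
      shared-≤ : ∀ {j} → K v j ≡ three → K l j ≡ three → ∑ shared ≤ ones K j
      shared-≤ {j} vj lj = ∑-mono at
        where
        at : ∀ x → shared x ≤ isOne (K j x)
        at x with K v x in vx | K l x in lx
        ... | one | _ = z≤n
        ... | two | _ = z≤n
        ... | three | one = z≤n
        ... | three | two = z≤n
        ... | three | three with square vj (trans (symmetric j l) lj) lx (trans (symmetric x v) vx)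
        ...   | inj₁ vl≡one with () ← trans (sym vl) vl≡one
        ...   | inj₂ jx = ≤-reflexive (sym (cong isOne jx))

      private
        bound : ∀ {t} → ∑ shared ≤ t → 864 * a ≤ 150 * n + 320 * t
        bound {t} small = +-cancelʳ-≤ (170 * n) _ _ (begin
          864 * a + 170 * n
            ≡⟨ ring a n ⟩
          85 * n + (85 * n + 544 * a) + 320 * a
            ≤⟨ +-monoˡ-≤ (320 * a) (+-mono-≤ (≤-trans (m≤m+n (85 * n) _) (rich l)) (rich v)) ⟩
          320 * threes K l + 320 * V + 320 * a
            ≡⟨ ring′ (threes K l) V a ⟩
          320 * (threes K l + (V + a))
            ≤⟨ *-monoʳ-≤ 320 (≤-trans cover (+-monoʳ-≤ n small)) ⟩
          320 * (n + t)
            ≡⟨ ring″ n t ⟩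
          150 * n + 320 * t + 170 * n ∎)
          where
          open ≤-Reasoning
          ring : ∀ a n → 864 * a + 170 * n ≡ 85 * n + (85 * n + 544 * a) + 320 * a
          ring = solve-∀
          ring′ : ∀ s t a → 320 * s + 320 * t + 320 * a ≡ 320 * (s + (t + a))
          ring′ = solve-∀
          ring″ : ∀ n t → 320 * (n + t) ≡ 150 * n + 320 * t + 170 * n
          ring″ = solve-∀

        edge-bound : ∀ {j} → K v j ≡ three → 544 * a + 544 * ones K j ≤ 150 * n
        edge-bound {j} vj = +-cancelʳ-≤ (170 * n) _ _ (begin
          544 * a + 544 * ones K j + 170 * n
            ≡⟨ ring a (ones K j) n ⟩
          85 * n + 544 * a + (85 * n + 544 * ones K j)
            ≤⟨ +-mono-≤ (rich v) (rich j) ⟩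
          320 * V + 320 * threes K j
            ≡⟨ sym (*-distribˡ-+ 320 V _) ⟩
          320 * (V + threes K j)
            ≤⟨ *-monoʳ-≤ 320 (disjoint-threes vj) ⟩
          320 * n
            ≡⟨ ring′ n ⟩
          150 * n + 170 * n ∎)
          where
          open ≤-Reasoning
          ring : ∀ a t n → 544 * a + 544 * t + 170 * n ≡ 85 * n + 544 * a + (85 * n + 544 * t)
          ring = solve-∀
          ring′ : ∀ n → 320 * n ≡ 150 * n + 170 * n
          ring′ = solve-∀

        impossible : ∀ p q → p * n ≤ q * n → q < p → ⊥
        impossible p q h q<p = <⇒≱ q<p (*-cancelʳ-≤ p q n {{nonZeroIndex v}} h)

      -- Without a common 3-neighbour of `v` and `l`, `cover` leaves too little room for the large
      -- class of `v`. With one, `j`, the overlap is at most `ones K j`, but then `j` and `v`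
      -- together have few 1-neighbours by `edge-bound`.
      no-two : ⊥
      no-two with any? (λ j → 0 <? shared j)
      ... | no none = impossible 170 150 (begin
        170 * n             ≡⟨ ring n ⟩
        2 * (85 * n)        ≤⟨ *-monoʳ-≤ 2 large ⟩
        2 * (416 * a)       ≡⟨ ring′ a ⟩
        832 * a             ≤⟨ *-monoˡ-≤ a (≤ᵇ⇒≤ 832 864 _) ⟩
        864 * a             ≤⟨ bound (≮⇒≥ (λ lt → none (positive lt))) ⟩
        150 * n + 320 * 0   ≡⟨ +-identityʳ _ ⟩
        150 * n             ∎) (≤ᵇ⇒≤ 151 170 _)
        where
        open ≤-Reasoning
        positive : 0 < ∑ shared → ∃ λ j → 0 < shared j
        positive lt = sum-exceeds shared (λ _ → 0)
          (subst (_< ∑ shared) (sym (∑-zero n)) lt)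
        ring : ∀ n → 170 * n ≡ 2 * (85 * n)
        ring = solve-∀
        ring′ : ∀ a → 2 * (416 * a) ≡ 832 * a
        ring′ = solve-∀
      ... | yes (j , _) with K v j in vj | K l j in lj
      ...   | three | three = impossible 4080 4050 (begin
        4080 * n               ≡⟨ ring₀ n ⟩
        48 * (85 * n)          ≤⟨ *-monoʳ-≤ 48 large ⟩
        48 * (416 * a)         ≡⟨ ring₁ a ⟩
        19968 * a              ≤⟨ *-monoˡ-≤ a (≤ᵇ⇒≤ 19968 20128 _) ⟩
        20128 * a              ≤⟨ +-cancelʳ-≤ (5440 * t) _ _ combined ⟩
        4050 * n               ∎) (≤ᵇ⇒≤ 4051 4080 _)
        where
        open ≤-Reasoning
        t = ones K j
        ring₀ : ∀ n → 4080 * n ≡ 48 * (85 * n)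
        ring₀ = solve-∀
        ring₁ : ∀ a → 48 * (416 * a) ≡ 19968 * a
        ring₁ = solve-∀
        ring₂ : ∀ a t → 20128 * a + 5440 * t ≡ 17 * (864 * a) + 10 * (544 * a + 544 * t)
        ring₂ = solve-∀
        ring₃ : ∀ n t → 17 * (150 * n + 320 * t) + 10 * (150 * n) ≡ 4050 * n + 5440 * t
        ring₃ = solve-∀
        -- The multipliers 17 and 10 eliminate t, as 17 · 320 = 10 · 544. What remains contradicts
        -- 48 times `large`.
        combined : 20128 * a + 5440 * t ≤ 4050 * n + 5440 * t
        combined = begin
          20128 * a + 5440 * t
            ≡⟨ ring₂ a t ⟩
          17 * (864 * a) + 10 * (544 * a + 544 * t)
            ≤⟨ +-mono-≤ (*-monoʳ-≤ 17 (bound (shared-≤ vj lj))) (*-monoʳ-≤ 10 (edge-bound vj)) ⟩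
          17 * (150 * n + 320 * t) + 10 * (150 * n)
            ≡⟨ ring₃ n t ⟩
          4050 * n + 5440 * t ∎

-- The optimum over `W` and its growth.

argmax-Fin : {n : ℕ} (f : Fin (suc n) → ℕ) → ∃ λ v → ∀ x → f x ≤ f v
argmax-Fin {zero} f = zero , λ { zero → ≤-refl }
argmax-Fin {suc n} f with argmax-Fin (f ∘ suc)
... | v , max with ≤-total (f zero) (f (suc v))
...   | inj₁ le = suc v , λ { zero → le ; (suc x) → max x }
...   | inj₂ ge = zero , λ { zero → ≤-refl ; (suc x) → ≤-trans (max x) ge }

argmax-Subset : {n : ℕ} (f : Subset n → ℕ) → ∃ λ L → ∀ L′ → f L′ ≤ f L
argmax-Subset {zero} f = [] , λ { [] → ≤-refl }
argmax-Subset {suc n} f with argmax-Subset (f ∘ (true ∷_)) | argmax-Subset (f ∘ (false ∷_))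
... | L , maxL | R , maxR with ≤-total (f (true ∷ L)) (f (false ∷ R))
...   | inj₁ le = false ∷ R , λ { (true ∷ L′) → ≤-trans (maxL L′) le ; (false ∷ L′) → maxR L′ }
...   | inj₂ ge = true ∷ L , λ { (true ∷ L′) → maxL L′ ; (false ∷ L′) → ≤-trans (maxR L′) ge }

-- By `P²` this is the square of `P (blow L)`, on the same scale as `Q`.
blow² : {n : ℕ} → Subset n → ℕ
blow² L = ∏ (λ i → ∏ (⊗.symmetrise (blow L) i))

head-degree : {n : ℕ} → Bool → Subset n → ℕ
head-degree b L = ∏ (λ j → crossW b (lookup L j))

crossW-comm : ∀ b c → crossW b c ≡ crossW c b
crossW-comm true true = refl
crossW-comm true false = refl
crossW-comm false true = refl
crossW-comm false false = refl

symmetrise-blow : {n : ℕ} (L : Subset n) (i j : Fin n) → i ≢ j →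
                  ⊗.symmetrise (blow L) i j ≡ crossW (lookup L i) (lookup L j)
symmetrise-blow L zero zero i≢j = ⊥-elim (i≢j refl)
symmetrise-blow (b ∷ L) zero (suc j) _ = refl
symmetrise-blow (b ∷ L) (suc i) zero _ = crossW-comm b (lookup L i)
symmetrise-blow (b ∷ L) (suc i) (suc j) i≢j = symmetrise-blow L i j (i≢j ∘ cong suc)

blow²-cons : {n : ℕ} (b : Bool) (L : Subset n) →
             blow² (b ∷ L) ≡ head-degree b L * head-degree b L * blow² L
blow²-cons b L = begin
  1 * e * ∏ (λ i → crossW b (lookup L i) * ∏ (⊗.symmetrise (blow L) i))
    ≡⟨ cong₂ _*_ (*-identityˡ e) (∏-distrib-* (λ i → crossW b (lookup L i)) (λ i → ∏ (⊗.symmetrise (blow L) i))) ⟩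
  e * (e * blow² L)
    ≡⟨ sym (*-assoc e e _) ⟩
  e * e * blow² L ∎
  where
  open ≡-Reasoning
  e = head-degree b L

blow²-positive : {n : ℕ} (L : Subset n) → 1 ≤ blow² L
blow²-positive [] = ≤-refl
blow²-positive (b ∷ L) = ≤-trans
  (*-mono-≤ (*-mono-≤ {1} {_} {1} e≥1 e≥1) (blow²-positive L)) (≤-reflexive (sym (blow²-cons b L)))
  where
  crossW≥1 : ∀ b c → 1 ≤ crossW b c
  crossW≥1 true true = ≤-refl
  crossW≥1 true false = s≤s z≤n
  crossW≥1 false true = s≤s z≤n
  crossW≥1 false false = s≤s z≤n
  e≥1 : 1 ≤ head-degree b L
  e≥1 = ∏-positive (λ j → crossW≥1 b (lookup L j))

trues falses : {n : ℕ} → Subset n → ℕ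
trues [] = 0
trues (true ∷ L) = suc (trues L)
trues (false ∷ L) = trues L
falses [] = 0
falses (true ∷ L) = falses L
falses (false ∷ L) = suc (falses L)

trues+falses : {n : ℕ} (L : Subset n) → trues L + falses L ≡ n
trues+falses [] = refl
trues+falses (true ∷ L) = cong suc (trues+falses L)
trues+falses (false ∷ L) = trans (+-suc _ _) (cong suc (trues+falses L))

head-degree-true : {n : ℕ} (L : Subset n) → head-degree true L ≡ 3 ^ falses L
head-degree-true [] = refl
head-degree-true (true ∷ L) = trans (*-identityˡ _) (head-degree-true L)
head-degree-true (false ∷ L) = cong (3 *_) (head-degree-true L)

head-degree-false : {n : ℕ} (L : Subset n) → head-degree false L ≡ 3 ^ trues L * 2 ^ falses L
head-degree-false [] = refl
head-degree-false (true ∷ L) = trans (cong (3 *_) (head-degree-false L)) (sym (*-assoc 3 (3 ^ trues L) _))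
head-degree-false (false ∷ L) = trans (cong (2 *_) (head-degree-false L)) (rotate (3 ^ trues L) (2 ^ falses L))
  where
  rotate : ∀ a b → 2 * (a * b) ≡ a * (2 * b)
  rotate = solve-∀

-- The multipliers 7 and 19 leave a surplus of 2 in both variables. For c = 207 this bounds a + b by
-- 2691, which is where the threshold 2699 in `growth` is contradicted.
both-short : ∀ a b c → 41 * b ≤ 111 * a + c → 41 * a ≤ 15 * b + c → 2 * (a + b) ≤ 26 * c
both-short a b c h h′ = +-cancelʳ-≤ (777 * a + 285 * b) (2 * (a + b)) (26 * c) (begin
  2 * (a + b) + (777 * a + 285 * b)     ≡⟨ ring a b ⟩
  7 * (41 * b) + 19 * (41 * a)          ≤⟨ +-mono-≤ (*-monoʳ-≤ 7 h) (*-monoʳ-≤ 19 h′) ⟩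
  7 * (111 * a + c) + 19 * (15 * b + c) ≡⟨ ring′ a b c ⟩
  26 * c + (777 * a + 285 * b)          ∎)
  where
  open ≤-Reasoning
  ring : ∀ a b → 2 * (a + b) + (777 * a + 285 * b) ≡ 7 * (41 * b) + 19 * (41 * a)
  ring = solve-∀
  ring′ : ∀ a b c → 7 * (111 * a + c) + 19 * (15 * b + c) ≡ 26 * c + (777 * a + 285 * b)
  ring′ = solve-∀

-- With a vertices in L and b in R, a new vertex has degree 3^b when put in L and 3^a 2^b when put
-- in R. For large a + b one of these exceeds 2^(37(a+b+1)/32) by a factor at least 2.
growth : {m : ℕ} (L : Subset m) → 2699 ≤ m → ∃ λ b → 2 ^ (37 * suc m + 32) ≤ head-degree b L ^ 32
-- The tests are the hypotheses of `19/12≤log₂3` for a new vertex in `L` and in `R`, after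
-- cancelling common terms and dividing by 4.
growth {m} L large with 111 * trues L + 207 ≤? 41 * falses L | 15 * falses L + 207 ≤? 41 * trues L
... | yes h | _ = true , (begin
  2 ^ (37 * suc m + 32)
    ≡⟨ cong (λ m → 2 ^ (37 * suc m + 32)) (sym (trues+falses L)) ⟩
  2 ^ (37 * suc (a + b) + 32)
    ≤⟨ 19/12≤log₂3 (37 * suc (a + b) + 32) (b * 32) exponents ⟩
  3 ^ (b * 32)
    ≡⟨ sym (^-*-assoc 3 b 32) ⟩
  (3 ^ b) ^ 32
    ≡⟨ cong (_^ 32) (sym (head-degree-true L)) ⟩
  head-degree true L ^ 32 ∎)
  where
  open ≤-Reasoning
  a = trues L
  b = falses L
  ring : ∀ a b → 12 * (37 * (1 + (a + b)) + 32) ≡ 4 * (111 * a + 207) + 444 * b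
  ring = solve-∀
  ring′ : ∀ b → 4 * (41 * b) + 444 * b ≡ 19 * (b * 32)
  ring′ = solve-∀
  exponents : 12 * (37 * suc (a + b) + 32) ≤ 19 * (b * 32)
  exponents = begin
    12 * (37 * suc (a + b) + 32)  ≡⟨ ring a b ⟩
    4 * (111 * a + 207) + 444 * b ≤⟨ +-monoˡ-≤ (444 * b) (*-monoʳ-≤ 4 h) ⟩
    4 * (41 * b) + 444 * b        ≡⟨ ring′ b ⟩
    19 * (b * 32)                 ∎
... | no _ | yes h = false , (begin
  2 ^ (37 * suc m + 32)
    ≡⟨ cong (λ m → 2 ^ (37 * suc m + 32)) (sym (trues+falses L)) ⟩
  2 ^ (37 * suc (a + b) + 32)
    ≡⟨ cong (2 ^_) (ring a b) ⟩
  2 ^ (37 * a + 5 * b + 69 + b * 32)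
    ≡⟨ ^-distribˡ-+-* 2 (37 * a + 5 * b + 69) (b * 32) ⟩
  2 ^ (37 * a + 5 * b + 69) * 2 ^ (b * 32)
    ≤⟨ *-monoˡ-≤ (2 ^ (b * 32)) (19/12≤log₂3 (37 * a + 5 * b + 69) (a * 32) exponents) ⟩
  3 ^ (a * 32) * 2 ^ (b * 32)
    ≡⟨ sym (cong₂ _*_ (^-*-assoc 3 a 32) (^-*-assoc 2 b 32)) ⟩
  (3 ^ a) ^ 32 * (2 ^ b) ^ 32
    ≡⟨ sym (^-distribʳ-* (3 ^ a) (2 ^ b) 32) ⟩
  (3 ^ a * 2 ^ b) ^ 32
    ≡⟨ cong (_^ 32) (sym (head-degree-false L)) ⟩
  head-degree false L ^ 32 ∎)
  where
  open ≤-Reasoning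
  a = trues L
  b = falses L
  ring : ∀ a b → 37 * (1 + (a + b)) + 32 ≡ 37 * a + 5 * b + 69 + b * 32
  ring = solve-∀
  ring′ : ∀ a b → 12 * (37 * a + 5 * b + 69) ≡ 4 * (15 * b + 207) + 444 * a
  ring′ = solve-∀
  ring″ : ∀ a → 4 * (41 * a) + 444 * a ≡ 19 * (a * 32)
  ring″ = solve-∀
  exponents : 12 * (37 * a + 5 * b + 69) ≤ 19 * (a * 32)
  exponents = begin
    12 * (37 * a + 5 * b + 69)    ≡⟨ ring′ a b ⟩
    4 * (15 * b + 207) + 444 * a  ≤⟨ +-monoˡ-≤ (444 * a) (*-monoʳ-≤ 4 h) ⟩
    4 * (41 * a) + 444 * a        ≡⟨ ring″ a ⟩
    19 * (a * 32)                 ∎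
... | no h | no h′ = ⊥-elim (≤⇒≤ᵇ {2 * 2699} {26 * 207} (≤-trans (*-monoʳ-≤ 2 large)
  (≤-trans (≤-reflexive (cong (2 *_) (sym (trues+falses L))))
           (both-short (trues L) (falses L) 207 (<⇒≤ (≰⇒> h)) (<⇒≤ (≰⇒> h′))))))

abstract
  -- Kept opaque: later arguments see the optimum only through `best²-attained` and `blow²≤best²`.
  best : (n : ℕ) → Subset n
  best n = proj₁ (argmax-Subset (blow² {n}))

  best² : ℕ → ℕ
  best² n = blow² (best n)

  best²-attained : (n : ℕ) → best² n ≡ blow² (best n)
  best²-attained n = refl

  blow²≤best² : {n : ℕ} (L : Subset n) → blow² L ≤ best² n
  blow²≤best² {n} = proj₂ (argmax-Subset (blow² {n}))

double-≤ : ∀ k x .{{_ : NonZero k}} d e → d ^ k < 2 ^ x → 2 ^ (x + k) ≤ e ^ k → 2 * d ≤ e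
double-≤ k x d e h h′ = ^-cancel-base-≤ k (begin
  (2 * d) ^ k      ≡⟨ ^-distribʳ-* 2 d k ⟩
  2 ^ k * d ^ k    ≤⟨ *-monoʳ-≤ (2 ^ k) (<⇒≤ h) ⟩
  2 ^ k * 2 ^ x    ≡⟨ *-comm (2 ^ k) (2 ^ x) ⟩
  2 ^ x * 2 ^ k    ≡⟨ sym (^-distribˡ-+-* 2 x k) ⟩
  2 ^ (x + k)      ≤⟨ h′ ⟩
  e ^ k            ∎)
  where open ≤-Reasoning

-- A vertex of small degree loses a factor 4 (of squared products) against the growth of best².
low-factor : ∀ {m} d → 2699 ≤ m → d ^ 32 < 2 ^ (37 * suc m) → 4 * (d * d * best² m) ≤ best² (suc m)
low-factor {m} d large low = begin
  4 * (d * d * best² m)        ≡⟨ ring d (best² m) ⟩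
  2 * d * (2 * d) * best² m    ≤⟨ *-monoˡ-≤ (best² m) (*-mono-≤ 2d≤e 2d≤e) ⟩
  e * e * best² m              ≡⟨ cong (e * e *_) (best²-attained m) ⟩
  e * e * blow² (best m)       ≡⟨ sym (blow²-cons b (best m)) ⟩
  blow² (b ∷ best m)           ≤⟨ blow²≤best² (b ∷ best m) ⟩
  best² (suc m)                ∎
  where
  open ≤-Reasoning
  b = proj₁ (growth (best m) large)
  e = head-degree b (best m)
  2d≤e : 2 * d ≤ e
  2d≤e = double-≤ 32 (37 * suc m) d e low (proj₂ (growth (best m) large))
  ring : ∀ d q → 4 * (d * d * q) ≡ 2 * d * (2 * d) * q
  ring = solve-∀

-- The induction on the number of vertices.

Q-≤ : {n : ℕ} (K : Graph n) → Q K ≤ 4 ^ (n * n)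
Q-≤ {n} K = ≤-trans (∏-≤ (deg K) (4 ^ n) (λ x → ∏-≤ (λ y → val (K x y)) 4 (λ y → val≤4 (K x y))))
                    (≤-reflexive (^-*-assoc 4 n n))
  where
  val≤4 : ∀ w → val w ≤ 4
  val≤4 one = s≤s z≤n
  val≤4 two = s≤s (s≤s z≤n)
  val≤4 three = s≤s (s≤s (s≤s z≤n))
  ∏-≤ : {m : ℕ} (f : Fin m → ℕ) (b : ℕ) → (∀ i → f i ≤ b) → ∏ f ≤ b ^ m
  ∏-≤ {zero} f b h = ≤-refl
  ∏-≤ {suc m} f b h = *-mono-≤ (h zero) (∏-≤ (f ∘ suc) b (h ∘ suc))

one? : ∀ w → Dec (w ≡ one)
one? one = yes refl
one? two = no λ ()
one? three = no λ ()

-- Take `L` to be the 1-neighbourhood of `v`. Inside it twins have weight 1, outside it weight 3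
-- would close a triangle with `v`, and across it 3 is the largest weight there is.
star-shaped : {n : ℕ} {K : Graph n} → Good K → (v : Fin n) →
              (∀ x y → K v x ≡ one → K x y ≡ K v y) → (∀ x → K v x ≢ two) → Q K ≤ best² n
star-shaped {n} {K} good v twins no-two = ≤-trans (∏-mono (λ x → ∏-mono (entry x))) (blow²≤best² L)
  where
  open Good good
  L : Subset n
  L = Vec.tabulate (λ x → does (one? (K v x)))
  val≤3 : ∀ w → val w ≤ 3
  val≤3 one = s≤s z≤n
  val≤3 two = s≤s (s≤s z≤n)
  val≤3 three = ≤-refl
  cross : ∀ x y → val (K x y) ≤ crossW (does (one? (K v x))) (does (one? (K v y)))
  cross x y with K v x in vx | K v y in vy
  ... | one | one rewrite twins x y vx | vy = ≤-refl
  ... | one | two = val≤3 (K x y)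
  ... | one | three = val≤3 (K x y)
  ... | two | _ = ⊥-elim (no-two x vx)
  ... | three | one = val≤3 (K x y)
  ... | three | two = ⊥-elim (no-two y vy)
  ... | three | three with K x y in xy
  ...   | one = s≤s z≤n
  ...   | two = ≤-refl
  ...   | three = ⊥-elim (triangle vx xy vy)
  entry : ∀ x y → val (K x y) ≤ ⊗.symmetrise (blow L) x y
  entry x y with x Fin.≟ y
  ... | yes refl rewrite diagonal x | ⊗.symmetrise-diag (blow L) x = ≤-refl
  ... | no x≢y rewrite symmetrise-blow L x y x≢y
                     | lookup∘tabulate (λ x → does (one? (K v x))) x
                     | lookup∘tabulate (λ x → does (one? (K v x))) y = cross x y

module Induction (N : ℕ) (N-large : ∀ {n} → n < 2700 → n * n + n ≤ N) where

  -- The second alternative absorbs the small n; it improves on the first as soon as n ≥ N.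
  Bound : ℕ → ℕ → Set
  Bound n q = q ≤ best² n ⊎ q * 4 ^ n ≤ 4 ^ N * best² n

  weaken : ∀ {n q q′} → q ≤ q′ → Bound n q′ → Bound n q
  weaken q≤q′ (inj₁ h) = inj₁ (≤-trans q≤q′ h)
  weaken {n} q≤q′ (inj₂ h) = inj₂ (≤-trans (*-monoˡ-≤ (4 ^ n) q≤q′) h)

  Low : {n : ℕ} → Graph n → Set
  Low {n} K = ∃ λ u → deg K u ^ 32 < 2 ^ (37 * n)

  low? : {n : ℕ} (K : Graph n) → Dec (Low K)
  low? {n} K = any? (λ u → deg K u ^ 32 <? 2 ^ (37 * n))

  rich : {n : ℕ} (K : Graph n) → ¬ Low K → Rich K
  rich K none u = rich-vertex K u (≮⇒≥ (λ low → none (u , low)))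

  -- `N` is chosen so that `4 ^ N` exceeds the crude bound `Q-≤` with a spare factor `4 ^ n`.
  small : ∀ {n} (K : Graph n) → n < 2700 → Bound n (Q K)
  small {n} K n< = inj₂ (begin
    Q K * 4 ^ n             ≤⟨ *-monoˡ-≤ (4 ^ n) (Q-≤ K) ⟩
    4 ^ (n * n) * 4 ^ n     ≡⟨ sym (^-distribˡ-+-* 4 (n * n) n) ⟩
    4 ^ (n * n + n)         ≤⟨ ^-monoʳ-≤ 4 (N-large n<) ⟩
    4 ^ N                   ≡⟨ sym (*-identityʳ _) ⟩
    4 ^ N * 1               ≤⟨ *-monoʳ-≤ (4 ^ N) (≤-trans (blow²-positive (best n)) (blow²≤best² (best n))) ⟩
    4 ^ N * best² n         ∎)
    where open ≤-Reasoning

  module Step {m : ℕ} (large : 2699 ≤ m) (ih : (K : Graph m) → Good K → Bound m (Q K)) where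

    -- By `low-factor` the optimum outgrows the deleted factor four times over. The first
    -- alternative discards this 4, the second uses it to raise the power of 4 on the left.
    low-case : (K : Graph (suc m)) → Good K → Low K → Bound (suc m) (Q K)
    low-case K good (u , low) rewrite Q-remove K good u
      with ih (pullback (punchIn u) K) (pullback-good (punchIn u) good)
    ... | inj₁ h = inj₁ (begin
      d * d * q                ≤⟨ *-monoʳ-≤ (d * d) h ⟩
      d * d * best² m          ≤⟨ m≤n*m (d * d * best² m) 4 ⟩
      4 * (d * d * best² m)    ≤⟨ low-factor {m} d large low ⟩
      best² (suc m)            ∎)
      where
      open ≤-Reasoning
      d = deg K u
      q = Q (pullback (punchIn u) K)
    ... | inj₂ h = inj₂ (begin
      d * d * q * (4 * 4 ^ m)            ≡⟨ ring d q (4 ^ m) ⟩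
      4 * (d * d) * (q * 4 ^ m)          ≤⟨ *-monoʳ-≤ (4 * (d * d)) h ⟩
      4 * (d * d) * (4 ^ N * best² m)    ≡⟨ ring′ d (4 ^ N) (best² m) ⟩
      4 ^ N * (4 * (d * d * best² m))    ≤⟨ *-monoʳ-≤ (4 ^ N) (low-factor {m} d large low) ⟩
      4 ^ N * best² (suc m)              ∎)
      where
      open ≤-Reasoning
      d = deg K u
      q = Q (pullback (punchIn u) K)
      ring : ∀ d q p → d * d * q * (4 * p) ≡ 4 * (d * d) * (q * p)
      ring = solve-∀
      ring′ : ∀ d p q → 4 * (d * d) * (p * q) ≡ p * (4 * (d * d * q))
      ring′ = solve-∀

    Improvable : Graph (suc m) → Set
    Improvable K = ∃ λ u → ∃ λ v → K u v ≡ one × deg K u < deg K v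

    improvable? : (K : Graph (suc m)) → Dec (Improvable K)
    improvable? K = any? (λ u → any? (λ v → one? (K u v) ×-dec (deg K u <? deg K v)))

    -- Richness is used on both sides of the absorption: in `K` it makes the class of `v` large, and
    -- in `absorbed` it rules out weight 2 at `v`.
    extremal-case : (K : Graph (suc m)) → Good K → ¬ Improvable K → Bound (suc m) (Q K)
    extremal-case K good stuck with low? K | argmax-Fin (ones K)
    ... | yes low | _ = low-case K good low
    ... | no none | v , max = weaken (absorb-≥ degrees) absorbed-bound
      where
      open Good good
      open Absorb K good v
      degrees : ∀ x → K v x ≡ one → deg K x ≤ deg K v
      degrees x vx = ≮⇒≥ (λ lt → stuck (v , x , vx , lt))
      class : ones absorbed v ≡ ones K v
      class = sum-cong-≗ (λ x → cong isOne (row-v x))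
      absorbed-bound : Bound (suc m) (Q absorbed)
      absorbed-bound with low? absorbed
      -- Absorption may create a vertex of low degree; deletion then applies to the absorbed graph
      -- itself.
      ... | yes low = low-case absorbed absorbed-good low
      ... | no none′ = inj₁ (star-shaped absorbed-good v twins
              (λ l → no-two absorbed-good (rich absorbed none′) v twins
                (subst (λ a → 85 * suc m ≤ 416 * a) (sym class) (largest-class good (rich K none) v max))))

    -- Cloning strictly increases `Q`, which is bounded by `Q-≤`; `fuel` is at least the distance
    -- left to that bound, so the process ends at a graph without improvement.
    climb : ∀ fuel (K : Graph (suc m)) → Good K → 4 ^ (suc m * suc m) ≤ Q K + fuel → Bound (suc m) (Q K)
    climb fuel K good enough with improvable? K
    ... | no stuck = extremal-case K good stuck
    ... | yes (u , v , uv , lt) = ascend fuel enough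
      where
      f = redirect u v
      up : Q K < Q (pullback f K)
      up = redirect-increases K good u v uv lt
      ascend : ∀ fuel → 4 ^ (suc m * suc m) ≤ Q K + fuel → Bound (suc m) (Q K)
      ascend zero enough = ⊥-elim (<⇒≱ up (≤-trans (Q-≤ (pullback f K)) (≤-trans enough (≤-reflexive (+-identityʳ _)))))
      ascend (suc fuel) enough = weaken (<⇒≤ up) (climb fuel (pullback f K) (pullback-good f good)
        (≤-trans enough (≤-trans (≤-reflexive (+-suc (Q K) fuel)) (+-monoˡ-≤ fuel up))))

  bound : ∀ n (K : Graph n) → Good K → Bound n (Q K)
  bound n K good with n <? 2700
  ... | yes n< = small K n<
  bound zero K good | no n≮ = ⊥-elim (n≮ (s≤s z≤n))
  -- The size is `suc m`, so 2700 here becomes the 2699 of `growth`. The initial fuel is the whole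
  -- bound on `Q`.
  bound (suc m) K good | no n≮ = Step.climb (s≤s⁻¹ (≮⇒≥ n≮)) (bound m) (4 ^ (suc m * suc m)) K good (m≤n+m _ (Q K))

  Q≤best² : ∀ {n} → N ≤ n → (K : Graph n) → Good K → Q K ≤ best² n
  Q≤best² {n} N≤n K good with bound n K good
  ... | inj₁ h = h
  ... | inj₂ h = *-cancelˡ-≤ (4 ^ N) {{m^n≢0 4 N}} (begin
    -- From size `N` on, the accumulated `4 ^ n` outweighs the initial loss `4 ^ N`.
    4 ^ N * Q K       ≤⟨ *-monoˡ-≤ (Q K) (^-monoʳ-≤ 4 N≤n) ⟩
    4 ^ n * Q K       ≡⟨ *-comm (4 ^ n) (Q K) ⟩
    Q K * 4 ^ n       ≤⟨ h ⟩
    4 ^ N * best² n   ∎)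
    where open ≤-Reasoning

-- Back to multigraphs and to `P`.

square-cancel-≤ : ∀ {a b} → a * a ≤ b * b → a ≤ b
square-cancel-≤ h = ≮⇒≥ (λ b<a → <⇒≱ (*-mono-< b<a b<a) h)

P-best : {n : ℕ} (H : Multigraph n) → P H * P H ≤ best² n → P H ≤ P (blow (best n))
P-best {n} H h = square-cancel-≤ (≤-trans h (≤-reflexive (trans (best²-attained n) (P² (blow (best n))))))

best-in-W : {n : ℕ} (H : Multigraph n) → InW H → P H ≤ P (blow (best n))
best-in-W H (L , pattern-L) = P-best H (≤-trans (≤-reflexive (trans (sym (P² H)) same)) (blow²≤best² L))
  where
  agree : ∀ i j → ⊗.symmetrise H i j ≡ ⊗.symmetrise (blow L) i j
  agree i j with toℕ i <ᵇ toℕ j in i<j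
  ... | true = pattern-L i j (<ᵇ⇒< _ _ (subst T (sym i<j) _))
  ... | false with toℕ j <ᵇ toℕ i in j<i
  ...   | true = pattern-L j i (<ᵇ⇒< _ _ (subst T (sym j<i) _))
  ...   | false = refl
  same : ∏ (λ i → ∏ (⊗.symmetrise H i)) ≡ blow² L
  same = ∏-cong (λ i → ∏-cong (agree i))

best-in-D : (N : ℕ) → (∀ {n} → n < 2700 → n * n + n ≤ N) → {n : ℕ} → N ≤ n →
            (H : Multigraph n) → InD H → P H ≤ P (blow (best n))
best-in-D N N-large n≥N H inD with P H ≟ 0
-- Weight 0 is allowed in `D` but makes the product vanish; otherwise all weights are 1, 2 or 3.
... | yes P≡0 = ≤-trans (≤-reflexive P≡0) z≤n
... | no P≢0 = P-best H (≤-trans (≤-reflexive same) (Induction.Q≤best² N N-large n≥N (graph H) graph-good))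
  where
  open FromD H inD P≢0
  same : P H * P H ≡ Q (graph H)
  same = trans (sym (P² H)) (∏-cong (λ i → ∏-cong (λ j → sym (val-graph i j))))

n²+n-mono : ∀ k {n} → n < k → n * n + n ≤ k * k + k
n²+n-mono k n<k = +-mono-≤ (*-mono-≤ (<⇒≤ n<k) (<⇒≤ n<k)) (<⇒≤ n<k)

theorem4p3 : Σ ℕ λ N → (n : ℕ) → n ≥ N →
    Σ (Multigraph n) λ G → Maximizes InD G × Maximizes InW G
-- The threshold dominates n² + n for every n below 2700, as the base of the induction requires.
theorem4p3 = 2700 * 2700 + 2700 , λ n n≥N →
  blow (best n) ,
  (blow-inD (best n) , best-in-D (2700 * 2700 + 2700) (n²+n-mono 2700) n≥N) ,
  (blow-inW (best n) , best-in-W)
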